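{- For every nonnegative integer $n$, $a(49n+15)\equiv a(49n+29)\equiv a(49n+36)\equiv a(49n+43)\equiv 0 \pmod 7$.
   Context: Let $(q;q)_\infty=\prod_{n=1}^\infty(1-q^n)$ and $(q^2;q^2)_\infty=\prod_{n=1}^\infty(1-q^{2n})$. The number of cubic partitions $a(n)$ is defined for $n\ge 0$ by the generating function $\sum_{n=0}^\infty a(n)q^n=\frac{1}{(q;q)_\infty(q^2;q^2)_\infty}$; equivalently, $a(n)$ is the number of pairs of partitions $(\lambda,\mu)$ with $|\lambda|+|\mu|=n$ and all parts of $\mu$ even. -}

module Defs where

open import Data.Nat using (ℕ; zero; suc; _+_; _*_; _∸_; _≤ᵇ_)
open import Data.Bool using (Bool; true; false; if_then_else_; _∧_)
open import Data.List using (List; map; upTo)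
open import Data.Nat.ListAction using (sum)

isEven : ℕ → Bool
isEven zero = true
isEven (suc zero) = false
isEven (suc (suc n)) = isEven n

-- partsLe ok k m : number of partitions of m (multisets of positive parts
-- summing to m) with every part ≤ k and satisfying ok.
-- Standard recursion: P(0,0)=1, P(0,m+1)=0,
--   P(k+1,m) = P(k,m) + [ok (k+1) and k+1 ≤ m] · P(k+1, m-(k+1)).
-- The inner recursion on m is made structural by a fuel argument f with f ≥ m.
partsLe : (ℕ → Bool) → ℕ → ℕ → ℕ
partsLe ok k m = go k m m
  where
  go : ℕ → ℕ → ℕ → ℕ
  go zero zero _ = 1
  go zero (suc _) _ = 0
  go (suc k) m zero = go k m zero
  go (suc k) m (suc f) =
    go k m (suc f) +
    (if ok (suc k) ∧ (suc k ≤ᵇ m) then go (suc k) (m ∸ suc k) f else 0)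

p : ℕ → ℕ
p m = partsLe (λ _ → true) m m

pEven : ℕ → ℕ
pEven m = partsLe isEven m m

-- Cubic partitions: pairs (λ, μ) with |λ| + |μ| = n and all parts of μ even,
-- i.e. a(n) = Σ_{j=0}^{n} p(j) · pEven(n - j).
-- (Equal to the q^n coefficient of 1/((q;q)_∞ (q²;q²)_∞).)
a : ℕ → ℕ
a n = sum (map (λ j → p j * pEven (n ∸ j)) (upTo (suc n)))

{-# OPTIONS --safe #-}
module Submission where

-- Let A = Σ a(n) qⁿ and θ = q d/dq. Liouville's elementary transformation of the sums over ax + by = n yields a level 2
-- analogue of Ramanujan's differential equations, 2θe = e𝒫 − Q and θQ = (𝒫 − e)Q for Eisenstein series e, 𝒫, Q, and
-- comparing logarithmic derivatives gives the exact identity A⁸ Q(e² − Q) = 64q. Modulo 7 the Eisenstein series of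
-- weight 6 becomes 1, so that everything is expressed through w = e²: one finds θw = 2(1 − w³), 4wq = gA⁸ with
-- g = w³ − 1, and θ²F = wF for F = q⁶A. Hence F − θ⁶F = 2w⁶gF, that is A⁷(F − θ⁶F) = (wq)⁷. As F − θ⁶F keeps the
-- coefficients of F at multiples of 7 and f⁷ = f(q⁷), the series C = Σ a(7k − 6)qᵏ satisfies AC = wq, so 4C = gA⁷.
-- Finally θ³g = g, so the coefficients of C vanish unless k³ = 1 modulo 7; the theorem is the cases k = 3, 5, 6, 0.

open import Data.Bool using (Bool; true; false; if_then_else_; _∧_; T)
import Data.Bool.Properties as Boolₚ
open import Data.Empty using (⊥-elim)
open import Data.Fin using (#_)
open import Data.Integer as ℤ using (ℤ; +_; 0ℤ; 1ℤ; -1ℤ)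
import Data.Integer.Properties as ℤₚ
open import Data.List using (List; []; _∷_; applyUpTo)
import Data.List.Properties as Listₚ
open import Data.Nat as ℕ using (ℕ; zero; suc; z≤n; s≤s; _≡ᵇ_; _≤ᵇ_; _∸_; _%_)
import Data.Nat.DivMod as DivMod
open import Data.Nat.Divisibility using (_∣_; divides)
open import Data.Nat.ListAction using (sum)
import Data.Nat.Properties as ℕₚ
import Data.Nat.Solver
open import Data.Product using (_,_; _×_; proj₁; proj₂)
open import Data.Sum using (_⊎_; inj₁; inj₂)
open import Data.Unit using (tt)
open import Data.Vec using (Vec; []; _∷_; lookup; map)
open import Data.Vec.Properties using (lookup-map)
open import Function using (_∘_; flip)
open import Relation.Nullary using (yes; no)

-- No infinite product is ever formed. With η₁ = η(q) and η₂ = η(q²), classically `Q` is η₁¹⁶/η₂⁸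
-- and e² - `Q` is 64η₂¹⁶/η₁⁸. This is why both have logarithmic derivatives linear in `e` and `𝒫`,
-- and why their product, 64η₁⁸η₂⁸, is matched with the eighth power of `A`. The theory of modular
-- forms is replaced by one uniqueness statement: θf = f forces f = f(1)q. It needs characteristic
-- zero, because modulo 7 the powers q⁸, q¹⁵, ... satisfy the same equation; so the identity for A⁸
-- is proved over ℤ and reduced only afterwards. Modulo 7 a single algebraic unknown remains: the
-- weight 4 relation removes `Q₁`, the weight 6 relation then fixes eQ in terms of `e`, and `𝒫` is
-- eliminated through the product w(2𝒫 - e). The price is a factor w in the first-order equations.
-- It is never inverted but cancelled, which is possible because `e` has constant term 1.

-- Finite sums and Liouville's transformation of ax + by = n

module FiniteSums where

  open import Data.Integer using (_+_; _*_)
  open import Data.Integer.Solver using (module +-*-Solver)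
  open import Relation.Binary.PropositionalEquality hiding ([_])

  Σ< : ℕ → (ℕ → ℤ) → ℤ
  Σ< zero    f = 0ℤ
  Σ< (suc n) f = Σ< n f + f n

  Σ-cong< : ∀ n {f g : ℕ → ℤ} → (∀ i → i ℕ.< n → f i ≡ g i) → Σ< n f ≡ Σ< n g
  Σ-cong< zero    f≗g = refl
  Σ-cong< (suc n) f≗g =
    cong₂ _+_ (Σ-cong< n λ i i<n → f≗g i (ℕₚ.m<n⇒m<1+n i<n)) (f≗g n (ℕₚ.n<1+n n))

  Σ-cong : ∀ n {f g : ℕ → ℤ} → (∀ i → f i ≡ g i) → Σ< n f ≡ Σ< n g
  Σ-cong n f≗g = Σ-cong< n λ i _ → f≗g i

  Σ-0 : ∀ n → Σ< n (λ _ → 0ℤ) ≡ 0ℤ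
  Σ-0 zero    = refl
  Σ-0 (suc n) = cong (_+ 0ℤ) (Σ-0 n)

  Σ-+ : ∀ n (f g : ℕ → ℤ) → Σ< n (λ i → f i + g i) ≡ Σ< n f + Σ< n g
  Σ-+ zero    f g = refl
  Σ-+ (suc n) f g = trans (cong (_+ (f n + g n)) (Σ-+ n f g))
    (solve 4 (λ a b c d → (a :+ b) :+ (c :+ d) := (a :+ c) :+ (b :+ d)) refl
       (Σ< n f) (Σ< n g) (f n) (g n))
    where open +-*-Solver

  Σ-* : ∀ n c (f : ℕ → ℤ) → Σ< n (λ i → c * f i) ≡ c * Σ< n f
  Σ-* zero    c f = sym (ℤₚ.*-zeroʳ c)
  Σ-* (suc n) c f =
    trans (cong (_+ c * f n) (Σ-* n c f)) (sym (ℤₚ.*-distribˡ-+ c (Σ< n f) (f n)))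

  Σ-const : ∀ n c → Σ< n (λ _ → c) ≡ + n * c
  Σ-const zero    c = sym (ℤₚ.*-zeroˡ c)
  Σ-const (suc n) c = trans (cong (_+ c) (Σ-const n c))
    (trans (ℤₚ.+-comm (+ n * c) c) (sym (ℤₚ.suc-* (+ n) c)))

  Σ-swap : ∀ m n (F : ℕ → ℕ → ℤ) →
           Σ< m (λ i → Σ< n (F i)) ≡ Σ< n (λ j → Σ< m (λ i → F i j))
  Σ-swap zero    n F = sym (Σ-0 n)
  Σ-swap (suc m) n F =
    trans (cong (_+ Σ< n (F m)) (Σ-swap m n F))
          (sym (Σ-+ n (λ j → Σ< m (λ i → F i j)) (F m)))

  Σ-front : ∀ n (f : ℕ → ℤ) → Σ< (suc n) f ≡ f 0 + Σ< n (f ∘ suc)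
  Σ-front zero    f = ℤₚ.+-comm 0ℤ (f 0)
  Σ-front (suc n) f =
    trans (cong (_+ f (suc n)) (Σ-front n f)) (ℤₚ.+-assoc (f 0) _ _)

  Σ-vanish : ∀ n {f : ℕ → ℤ} → (∀ i → f i ≡ 0ℤ) → Σ< n f ≡ 0ℤ
  Σ-vanish n f≗0 = trans (Σ-cong n f≗0) (Σ-0 n)

  Σ-extend : ∀ {m n} (f : ℕ → ℤ) → m ℕ.≤ n → (∀ i → m ℕ.≤ i → f i ≡ 0ℤ) → Σ< n f ≡ Σ< m f
  Σ-extend {zero}  {n}     f z≤n       f0 = Σ-vanish n λ i → f0 i z≤n
  Σ-extend {suc m} {suc n} f (s≤s m≤n) f0 = trans (Σ-front n f) (trans
    (cong (λ z → f 0 + z) (Σ-extend (f ∘ suc) m≤n λ i m≤i → f0 (suc i) (s≤s m≤i)))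
    (sym (Σ-front m f)))

  Σ²-cong : ∀ m n {F G : ℕ → ℕ → ℤ} → (∀ i j → F i j ≡ G i j) →
            Σ< m (λ i → Σ< n (F i)) ≡ Σ< m (λ i → Σ< n (G i))
  Σ²-cong m n F≗G = Σ-cong m λ i → Σ-cong n (F≗G i)

  Σ²-+ : ∀ m n (F G : ℕ → ℕ → ℤ) → Σ< m (λ i → Σ< n (λ j → F i j + G i j)) ≡
         Σ< m (λ i → Σ< n (F i)) + Σ< m (λ i → Σ< n (G i))
  Σ²-+ m n F G = trans (Σ-cong m λ i → Σ-+ n (F i) (G i)) (Σ-+ m _ _)

  Σ²-* : ∀ m n c (F : ℕ → ℕ → ℤ) → Σ< m (λ i → Σ< n (λ j → c * F i j)) ≡
         c * Σ< m (λ i → Σ< n (F i))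
  Σ²-* m n c F = trans (Σ-cong m λ i → Σ-* n c (F i)) (Σ-* m c _)

  -- Peels off the first row and the first column of the square. The range `m` of the gap `c` is
  -- independent of `n` because the induction shrinks only `n`; the vanishing hypotheses make the
  -- surplus terms zero.
  trichotomy : ∀ n m → n ℕ.≤ m → (F : ℕ → ℕ → ℤ) →
    (∀ i j → n ℕ.≤ i → F i j ≡ 0ℤ) → (∀ i j → n ℕ.≤ j → F i j ≡ 0ℤ) →
    Σ< n (λ i → Σ< n (F i)) ≡
      Σ< n (λ j → Σ< m (λ c → F (suc (j ℕ.+ c)) j)) +
      Σ< n (λ i → Σ< m (λ c → F i (suc (i ℕ.+ c)))) +
      Σ< n (λ i → F i i)
  trichotomy zero    m       n≤m       F F0ˡ F0ʳ = refl
  trichotomy (suc n) (suc m) (s≤s n≤m) F F0ˡ F0ʳ = begin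
    Σ< (suc n) (λ i → Σ< (suc n) (F i))
      ≡⟨ Σ-front n _ ⟩
    Σ< (suc n) (F 0) + Σ< n (λ i → Σ< (suc n) (F (suc i)))
      ≡⟨ cong₂ _+_ (Σ-front n (F 0)) (trans (Σ-cong n λ i → Σ-front n (F (suc i)))
           (Σ-+ n (λ i → F (suc i) 0) (λ i → Σ< n (F (suc i) ∘ suc)))) ⟩
    (F 0 0 + u) + (v + Σ< n (λ i → Σ< n (F′ i)))
      ≡⟨ cong (λ z → (F 0 0 + u) + (v + z)) (trichotomy n (suc m) (ℕₚ.m≤n⇒m≤1+n n≤m) F′
           (λ i j n≤i → F0ˡ (suc i) (suc j) (s≤s n≤i))
           (λ i j n≤j → F0ʳ (suc i) (suc j) (s≤s n≤j))) ⟩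
    (F 0 0 + u) + (v + (x + y + z))
      ≡⟨ solve 6 (λ a u v x y z → (a :+ u) :+ (v :+ (x :+ y :+ z)) :=
                    (v :+ x) :+ (u :+ y) :+ (a :+ z)) refl (F 0 0) u v x y z ⟩
    (v + x) + (u + y) + (F 0 0 + z)
      ≡⟨ cong₂ _+_ (cong₂ _+_
           (trans (cong (_+ x) (sym (Σ-extend (λ c → F (suc c) 0) (ℕₚ.m≤n⇒m≤1+n n≤m)
               λ i n≤i → F0ˡ (suc i) 0 (s≤s n≤i))))
             (sym (Σ-front n λ j → Σ< (suc m) (λ c → F (suc (j ℕ.+ c)) j))))
           (trans (cong (_+ y) (sym (Σ-extend (λ c → F 0 (suc c)) (ℕₚ.m≤n⇒m≤1+n n≤m)
               λ i n≤i → F0ʳ 0 (suc i) (s≤s n≤i))))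
             (sym (Σ-front n λ i → Σ< (suc m) (λ c → F i (suc (i ℕ.+ c)))))))
           (sym (Σ-front n λ i → F i i)) ⟩
    Σ< (suc n) (λ j → Σ< (suc m) (λ c → F (suc (j ℕ.+ c)) j)) +
    Σ< (suc n) (λ i → Σ< (suc m) (λ c → F i (suc (i ℕ.+ c)))) +
    Σ< (suc n) (λ i → F i i) ∎
    where
    open ≡-Reasoning
    open +-*-Solver
    F′ : ℕ → ℕ → ℤ
    F′ i j = F (suc i) (suc j)
    u = Σ< n (F 0 ∘ suc)
    v = Σ< n (λ i → F (suc i) 0)
    x = Σ< n (λ j → Σ< (suc m) (λ c → F′ (suc (j ℕ.+ c)) j))
    y = Σ< n (λ i → Σ< (suc m) (λ c → F′ i (suc (i ℕ.+ c))))
    z = Σ< n (λ i → F′ i i)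

  -- 0-based indices make the sum of two positive integers suc (i + j).
  triangle : ∀ n m → n ℕ.≤ m → (F : ℕ → ℕ → ℤ) → (∀ i s → n ℕ.≤ s → F i s ≡ 0ℤ) →
    Σ< n (λ i → Σ< m (λ j → F i (suc (i ℕ.+ j)))) ≡ Σ< n (λ s → Σ< s (λ i → F i s))
  triangle zero    m       n≤m       F F0 = refl
  triangle (suc n) (suc m) (s≤s n≤m) F F0 = begin
    Σ< (suc n) (λ i → Σ< (suc m) (λ j → F i (suc (i ℕ.+ j))))
      ≡⟨ Σ-front n _ ⟩
    Σ< (suc m) (λ j → F 0 (suc j)) + Σ< n (λ i → Σ< (suc m) (λ j → F′ i (suc (i ℕ.+ j))))
      ≡⟨ cong₂ _+_ (Σ-extend (λ j → F 0 (suc j)) (ℕₚ.m≤n⇒m≤1+n n≤m)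
                     λ i n≤i → F0 0 (suc i) (s≤s n≤i))
           (triangle n (suc m) (ℕₚ.m≤n⇒m≤1+n n≤m) F′
              λ i s n≤s → F0 (suc i) (suc s) (s≤s n≤s)) ⟩
    Σ< n (λ s → F 0 (suc s)) + Σ< n (λ s → Σ< s (λ i → F′ i s))
      ≡⟨ Σ-+ n _ _ ⟨
    Σ< n (λ s → F 0 (suc s) + Σ< s (λ i → F′ i s))
      ≡⟨ Σ-cong n (λ s → Σ-front s (λ i → F i (suc s))) ⟨
    Σ< n (λ s → Σ< (suc s) (λ i → F i (suc s)))
      ≡⟨ ℤₚ.+-identityˡ _ ⟨
    0ℤ + Σ< n (λ s → Σ< (suc s) (λ i → F i (suc s)))
      ≡⟨ Σ-front n (λ s → Σ< s (λ i → F i s)) ⟨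
    Σ< (suc n) (λ s → Σ< s (λ i → F i s)) ∎
    where
    open ≡-Reasoning
    F′ : ℕ → ℕ → ℤ
    F′ i s = F (suc i) (suc s)

  -- As a function of `n`, `δ m` is also the power series qᵐ.
  δ : ℕ → ℕ → ℤ
  δ m n = if m ≡ᵇ n then 1ℤ else 0ℤ

  δ-≢ : ∀ {m n} → m ≢ n → δ m n ≡ 0ℤ
  δ-≢ {m} {n} m≢n with m ≡ᵇ n in eq
  ... | false = refl
  ... | true  = ⊥-elim (m≢n (ℕₚ.≡ᵇ⇒≡ m n (subst T (sym eq) tt)))

  δ-> : ∀ {m n} → n ℕ.< m → δ m n ≡ 0ℤ
  δ-> n<m = δ-≢ (ℕₚ.<⇒≢ n<m ∘ sym)

  δ-subst : ∀ m n (f : ℕ → ℤ) → δ m n * f m ≡ δ m n * f n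
  δ-subst m n f with m ℕ.≟ n
  ... | yes refl = refl
  ... | no  m≢n  = trans (cong (_* f m) (δ-≢ m≢n)) (sym (cong (_* f n) (δ-≢ m≢n)))

  term : ℕ → (ℕ → ℕ → ℤ) → ℕ → ℕ → ℕ → ℕ → ℤ
  term n G a b x y = δ (suc a ℕ.* suc x ℕ.+ suc b ℕ.* suc y) n * G (suc a) (suc b)

  Σ⁴ : ℕ → (ℕ → ℕ → ℕ → ℕ → ℤ) → ℤ
  Σ⁴ n F = Σ< n λ a → Σ< n λ b → Σ< n λ x → Σ< n λ y → F a b x y

  -- Positive a, b, x, y with ax + by = n are all at most n, so cutting every range at `n` loses no
  -- solution.
  quadSum : ℕ → (ℕ → ℕ → ℤ) → ℤ
  quadSum n G = Σ⁴ n (term n G)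

  0*≡0 : ∀ {x} y → x ≡ 0ℤ → x * y ≡ 0ℤ
  0*≡0 y refl = ℤₚ.*-zeroˡ y

  module _ {n : ℕ} where
    private
      <-a : ∀ a b x y → n ℕ.≤ a → n ℕ.< suc a ℕ.* suc x ℕ.+ suc b ℕ.* suc y
      <-a a b x y n≤a = ℕₚ.≤-trans (s≤s n≤a)
        (ℕₚ.≤-trans (ℕₚ.m≤m*n (suc a) (suc x)) (ℕₚ.m≤m+n _ _))
      <-x : ∀ a b x y → n ℕ.≤ x → n ℕ.< suc a ℕ.* suc x ℕ.+ suc b ℕ.* suc y
      <-x a b x y n≤x = ℕₚ.≤-trans (s≤s n≤x)
        (ℕₚ.≤-trans (ℕₚ.m≤n*m (suc x) (suc a)) (ℕₚ.m≤m+n _ _))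
      <-b : ∀ a b x y → n ℕ.≤ b → n ℕ.< suc a ℕ.* suc x ℕ.+ suc b ℕ.* suc y
      <-b a b x y n≤b = subst (n ℕ.<_) (ℕₚ.+-comm (suc b ℕ.* suc y) (suc a ℕ.* suc x)) (<-a b a y x n≤b)
      <-y : ∀ a b x y → n ℕ.≤ y → n ℕ.< suc a ℕ.* suc x ℕ.+ suc b ℕ.* suc y
      <-y a b x y n≤y = subst (n ℕ.<_) (ℕₚ.+-comm (suc b ℕ.* suc y) (suc a ℕ.* suc x)) (<-x b a y x n≤y)

    quad-split-ab : ∀ G → quadSum n G ≡
      Σ⁴ n (λ b c x y → term n G (suc (b ℕ.+ c)) b x y) +
      Σ⁴ n (λ a c x y → term n G a (suc (a ℕ.+ c)) x y) +
      Σ< n (λ a → Σ< n λ x → Σ< n λ y → term n G a a x y)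
    quad-split-ab G = trichotomy n n ℕₚ.≤-refl
      (λ a b → Σ< n λ x → Σ< n λ y → term n G a b x y)
      (λ a b n≤a → Σ-vanish n λ x → Σ-vanish n λ y → 0*≡0 _ (δ-> (<-a a b x y n≤a)))
      (λ a b n≤b → Σ-vanish n λ x → Σ-vanish n λ y → 0*≡0 _ (δ-> (<-b a b x y n≤b)))

    quad-split-xy : ∀ G → quadSum n G ≡
      Σ⁴ n (λ a b y c → term n G a b (suc (y ℕ.+ c)) y) +
      Σ⁴ n (λ a b x c → term n G a b x (suc (x ℕ.+ c))) +
      Σ< n (λ a → Σ< n λ b → Σ< n λ x → term n G a b x x)
    quad-split-xy G =
      trans (Σ²-cong n n λ a b → trichotomy n n ℕₚ.≤-refl (term n G a b)
              (λ x y n≤x → 0*≡0 _ (δ-> (<-x a b x y n≤x)))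
              (λ x y n≤y → 0*≡0 _ (δ-> (<-y a b x y n≤y))))
      (trans (Σ²-+ n n _ _) (cong₂ _+_ (Σ²-+ n n _ _) refl))

    -- The substitution (a, b, x, y) ↦ (a − b, b, x, x + y) carries the solutions of ax + by = n with a > b to those
    -- with x < y; comparing both trichotomies leaves only the diagonals a = b and x = y.
    liouville : (H : ℕ → ℕ → ℤ) → (∀ a c → H a (a ℕ.+ c) ≡ H (a ℕ.+ c) c) →
      quadSum n H + Σ< n (λ a → Σ< n λ b → Σ< n λ x → term n (λ a b → H (a ℕ.+ b) b) a b x x) ≡
      quadSum n (λ a b → H (a ℕ.+ b) b) + Σ< n (λ a → Σ< n λ x → Σ< n λ y → term n H a a x y)
    liouville H H-sym = begin
      quadSum n H + d₂
        ≡⟨ cong (_+ d₂) (quad-split-ab H) ⟩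
      p + q + d₁ + d₂
        ≡⟨ cong (λ z → z + d₁ + d₂) (cong₂ _+_ p≡r q≡s) ⟩
      r + s + d₁ + d₂
        ≡⟨ solve 4 (λ r s d₁ d₂ → r :+ s :+ d₁ :+ d₂ := s :+ r :+ d₂ :+ d₁) refl r s d₁ d₂ ⟩
      s + r + d₂ + d₁
        ≡⟨ cong (_+ d₁) (quad-split-xy H′) ⟨
      quadSum n H′ + d₁ ∎
      where
      open ≡-Reasoning
      open +-*-Solver
      H′ : ℕ → ℕ → ℤ
      H′ a b = H (a ℕ.+ b) b
      p = Σ⁴ n (λ b c x y → term n H (suc (b ℕ.+ c)) b x y)
      q = Σ⁴ n (λ a c x y → term n H a (suc (a ℕ.+ c)) x y)
      d₁ = Σ< n (λ a → Σ< n λ x → Σ< n λ y → term n H a a x y)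
      d₂ = Σ< n (λ a → Σ< n λ b → Σ< n λ x → term n H′ a b x x)
      s = Σ⁴ n (λ a b y c → term n H′ a b (suc (y ℕ.+ c)) y)
      r = Σ⁴ n (λ a b x c → term n H′ a b x (suc (x ℕ.+ c)))
      open import Data.Nat.Solver renaming (module +-*-Solver to ℕ-Solver)
      p≡r : p ≡ r
      p≡r = trans (Σ-swap n n _) (Σ²-cong n n λ c b → Σ²-cong n n λ x y →
        cong₂ (λ k m → δ k n * H m (suc b))
          (S.solve 4 (λ b c x y → (S.con 2 S.:+ (b S.:+ c)) S.:* (S.con 1 S.:+ x)
                S.:+ (S.con 1 S.:+ b) S.:* (S.con 1 S.:+ y) S.:=
              (S.con 1 S.:+ c) S.:* (S.con 1 S.:+ x)
                S.:+ (S.con 1 S.:+ b) S.:* (S.con 2 S.:+ (x S.:+ y))) refl b c x y)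
          (cong suc (trans (cong suc (ℕₚ.+-comm b c)) (sym (ℕₚ.+-suc c b)))))
        where module S = ℕ-Solver
      -- The solutions with a < b go to those with x > y by ax + (a + c)y = a(x + y) + cy. The
      -- weight changes from H(a, a + c) to H(a + c, c), which is where `H-sym` is needed.
      q≡s : q ≡ s
      q≡s = Σ²-cong n n λ a c → trans (Σ-swap n n _) (Σ²-cong n n λ y x →
        cong₂ (λ k m → δ k n * m)
          (S.solve 4 (λ a c x y → (S.con 1 S.:+ a) S.:* (S.con 1 S.:+ x)
                S.:+ (S.con 2 S.:+ (a S.:+ c)) S.:* (S.con 1 S.:+ y) S.:=
              (S.con 1 S.:+ a) S.:* (S.con 2 S.:+ (y S.:+ x))
                S.:+ (S.con 1 S.:+ c) S.:* (S.con 1 S.:+ y)) refl a c x y)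
          (trans (cong (H (suc a)) (cong suc (sym (ℕₚ.+-suc a c)))) (H-sym (suc a) (suc c))))
        where module S = ℕ-Solver

-- The ring of power series with θ = q d/dq, exactly and modulo 7

module PowerSeries where

  open FiniteSums
  open import Data.Integer using (-_; _+_; _*_; _-_)
  open import Data.Integer.Solver using (module +-*-Solver)
  open import Algebra using (CommutativeRing)
  open import Algebra.Structures using (IsCommutativeRing)
  open import Relation.Binary using (Rel; IsEquivalence)
  open import Level using (0ℓ)
  open import Relation.Binary.PropositionalEquality hiding ([_])

  Series : Set
  Series = ℕ → ℤ

  infixl 6 _⊕_
  infixl 7 _⊛_ _•_

  _⊕_ : Series → Series → Series
  (f ⊕ g) n = f n + g n

  ⊖_ : Series → Series
  (⊖ f) n = - f n

  _•_ : ℤ → Series → Series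
  (c • f) n = c * f n

  _⊛_ : Series → Series → Series
  (f ⊛ g) zero    = f 0 * g 0
  (f ⊛ g) (suc n) = f 0 * g (suc n) + ((f ∘ suc) ⊛ g) n

  K : ℤ → Series
  K c zero    = c
  K c (suc _) = 0ℤ

  θ : Series → Series
  θ f n = + n * f n

  0⊛ : ∀ {f} → (∀ i → f i ≡ 0ℤ) → ∀ g n → (f ⊛ g) n ≡ 0ℤ
  0⊛ f0 g zero    = 0*≡0 (g 0) (f0 0)
  0⊛ f0 g (suc n) = cong₂ _+_ (0*≡0 (g (suc n)) (f0 0)) (0⊛ (f0 ∘ suc) g n)

  K-⊛ : ∀ c f n → (K c ⊛ f) n ≡ c * f n
  K-⊛ c f zero    = refl
  K-⊛ c f (suc n) =
    trans (cong (λ z → c * f (suc n) + z) (0⊛ (λ _ → refl) f n)) (ℤₚ.+-identityʳ _)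

  ⊛-distribʳ : ∀ h f g n → ((f ⊕ g) ⊛ h) n ≡ (f ⊛ h) n + (g ⊛ h) n
  ⊛-distribʳ h f g zero    = ℤₚ.*-distribʳ-+ (h 0) (f 0) (g 0)
  ⊛-distribʳ h f g (suc n) =
    trans (cong (λ z → (f 0 + g 0) * h (suc n) + z) (⊛-distribʳ h (f ∘ suc) (g ∘ suc) n))
      (solve 5 (λ a b c x y → (a :+ b) :* c :+ (x :+ y) := (a :* c :+ x) :+ (b :* c :+ y)) refl
        (f 0) (g 0) (h (suc n)) _ _)
    where open +-*-Solver

  •-⊛ : ∀ c f g n → ((c • f) ⊛ g) n ≡ c * (f ⊛ g) n
  •-⊛ c f g zero    = ℤₚ.*-assoc c (f 0) (g 0)
  •-⊛ c f g (suc n) =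
    trans (cong (λ z → c * f 0 * g (suc n) + z) (•-⊛ c (f ∘ suc) g n))
      (solve 4 (λ c a b x → c :* a :* b :+ c :* x := c :* (a :* b :+ x)) refl c (f 0) (g (suc n)) _)
    where open +-*-Solver

  ⊛-sucʳ : ∀ f g n → (f ⊛ g) (suc n) ≡ f (suc n) * g 0 + (f ⊛ (g ∘ suc)) n
  ⊛-sucʳ f g zero    = ℤₚ.+-comm (f 0 * g 1) (f 1 * g 0)
  ⊛-sucʳ f g (suc n) =
    trans (cong (λ z → f 0 * g (suc (suc n)) + z) (⊛-sucʳ (f ∘ suc) g n))
      (solve 3 (λ a b c → a :+ (b :+ c) := b :+ (a :+ c)) refl
        (f 0 * g (suc (suc n))) (f (suc (suc n)) * g 0) _)
    where open +-*-Solver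

  ⊛-comm : ∀ f g n → (f ⊛ g) n ≡ (g ⊛ f) n
  ⊛-comm f g zero    = ℤₚ.*-comm (f 0) (g 0)
  ⊛-comm f g (suc n) =
    trans (cong₂ _+_ (ℤₚ.*-comm (f 0) (g (suc n))) (⊛-comm (f ∘ suc) g n))
          (sym (⊛-sucʳ g f n))

  ⊛-assoc : ∀ f g h n → ((f ⊛ g) ⊛ h) n ≡ (f ⊛ (g ⊛ h)) n
  ⊛-assoc f g h zero    = ℤₚ.*-assoc (f 0) (g 0) (h 0)
  ⊛-assoc f g h (suc n) = begin
    f 0 * g 0 * h (suc n) + (((f 0 • (g ∘ suc)) ⊕ ((f ∘ suc) ⊛ g)) ⊛ h) n
      ≡⟨ cong (λ z → f 0 * g 0 * h (suc n) + z) (trans (⊛-distribʳ h _ _ n)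
           (cong₂ _+_ (•-⊛ (f 0) (g ∘ suc) h n) (⊛-assoc (f ∘ suc) g h n))) ⟩
    f 0 * g 0 * h (suc n) + (f 0 * ((g ∘ suc) ⊛ h) n + ((f ∘ suc) ⊛ (g ⊛ h)) n)
      ≡⟨ solve 5 (λ a b c x y → a :* b :* c :+ (a :* x :+ y) := a :* (b :* c :+ x) :+ y) refl
           (f 0) (g 0) (h (suc n)) _ _ ⟩
    f 0 * (g ⊛ h) (suc n) + ((f ∘ suc) ⊛ (g ⊛ h)) n ∎
    where
    open ≡-Reasoning
    open +-*-Solver

  θ-⊛ : ∀ f g n → θ (f ⊛ g) n ≡ (θ f ⊛ g) n + (f ⊛ θ g) n
  θ-⊛ f g zero    = sym (cong₂ _+_ (ℤₚ.*-zeroˡ (g 0)) (ℤₚ.*-zeroʳ (f 0)))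
  θ-⊛ f g (suc n) = begin
    + suc n * (f 0 * g (suc n) + (f′ ⊛ g) n)
      ≡⟨ solve 4 (λ m a b x → (con 1ℤ :+ m) :* (a :* b :+ x) :=
            (con 1ℤ :+ m) :* (a :* b) :+ x :+ m :* x) refl (+ n) (f 0) (g (suc n)) _ ⟩
    + suc n * (f 0 * g (suc n)) + (f′ ⊛ g) n + θ (f′ ⊛ g) n
      ≡⟨ cong (λ z → + suc n * (f 0 * g (suc n)) + (f′ ⊛ g) n + z) (θ-⊛ f′ g n) ⟩
    + suc n * (f 0 * g (suc n)) + (f′ ⊛ g) n + ((θ f′ ⊛ g) n + (f′ ⊛ θ g) n)
      ≡⟨ solve 6 (λ m a b x y z → (con 1ℤ :+ m) :* (a :* b) :+ x :+ (y :+ z) :=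
            (con 0ℤ :* b :+ (y :+ x)) :+ (a :* ((con 1ℤ :+ m) :* b) :+ z)) refl
            (+ n) (f 0) (g (suc n)) ((f′ ⊛ g) n) ((θ f′ ⊛ g) n) ((f′ ⊛ θ g) n) ⟩
    (0ℤ * g (suc n) + ((θ f′ ⊛ g) n + (f′ ⊛ g) n)) + (f 0 * (+ suc n * g (suc n)) + (f′ ⊛ θ g) n)
      ≡⟨ cong (λ z → (0ℤ * g (suc n) + z) + (f ⊛ θ g) (suc n))
           (trans (sym (⊛-distribʳ g (θ f′) f′ n)) (⊛-local≡ n λ i → tail-θ i)) ⟩
    (θ f ⊛ g) (suc n) + (f ⊛ θ g) (suc n) ∎
    where
    open ≡-Reasoning
    open +-*-Solver
    f′ : Series
    f′ = f ∘ suc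
    tail-θ : ∀ i → + i * f′ i + f′ i ≡ + suc i * f′ i
    tail-θ i = solve 2 (λ m x → m :* x :+ x := (con 1ℤ :+ m) :* x) refl (+ i) (f′ i)
    ⊛-local≡ : ∀ n {f f₁ : Series} → (∀ i → f i ≡ f₁ i) → (f ⊛ g) n ≡ (f₁ ⊛ g) n
    ⊛-local≡ zero    eq = cong (_* g 0) (eq 0)
    ⊛-local≡ (suc n) eq = cong₂ (λ x y → x * g (suc n) + y) (eq 0) (⊛-local≡ n (eq ∘ suc))

  -- The coefficient relation is a parameter so that equality and congruence modulo 7 share one
  -- carrier: an exact identity passes to the mod 7 ring through `≡⇒≋`, with no quotient or
  -- reduction map.
  module SeriesRing
    (_~_ : Rel ℤ 0ℓ) (~-equiv : IsEquivalence _~_)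
    (+-cong : ∀ {x y u v} → x ~ y → u ~ v → (x + u) ~ (y + v))
    (*-cong : ∀ {x y u v} → x ~ y → u ~ v → (x * u) ~ (y * v)) where

    open IsEquivalence ~-equiv public
      using () renaming (refl to ~-refl; sym to ~-sym; trans to ~-trans; reflexive to ~-reflexive)

    infix 4 _≋_
    _≋_ : Rel Series 0ℓ
    f ≋ g = ∀ n → f n ~ g n

    ≡⇒≋ : ∀ {f g : Series} → (∀ n → f n ≡ g n) → f ≋ g
    ≡⇒≋ eq n = ~-reflexive (eq n)

    -- Coefficient `n` of a product only sees coefficients up to `n`. The bounded form allows
    -- truncations that depend on `n` to replace the full series.
    ⊛-cong≤ : ∀ n {f f′ g g′} → (∀ i → i ℕ.≤ n → f i ~ f′ i) → (∀ i → i ℕ.≤ n → g i ~ g′ i) →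
              (f ⊛ g) n ~ (f′ ⊛ g′) n
    ⊛-cong≤ zero    p q = *-cong (p 0 z≤n) (q 0 z≤n)
    ⊛-cong≤ (suc n) p q = +-cong (*-cong (p 0 z≤n) (q (suc n) ℕₚ.≤-refl))
      (⊛-cong≤ n (λ i i≤n → p (suc i) (s≤s i≤n)) (λ i i≤n → q i (ℕₚ.m≤n⇒m≤1+n i≤n)))

    ⊛-cong : ∀ {f f′ g g′} → f ≋ f′ → g ≋ g′ → (f ⊛ g) ≋ (f′ ⊛ g′)
    ⊛-cong p q n = ⊛-cong≤ n (λ i _ → p i) (λ i _ → q i)

    private
      -‿cong : ∀ {x y} → x ~ y → (- x) ~ (- y)
      -‿cong {x} {y} p = ~-trans (~-reflexive (sym (ℤₚ.-1*i≡-i x)))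
        (~-trans (*-cong { -1ℤ} ~-refl p) (~-reflexive (ℤₚ.-1*i≡-i y)))

      ⊛-identityˡ : ∀ f n → (K 1ℤ ⊛ f) n ≡ f n
      ⊛-identityˡ f n = trans (K-⊛ 1ℤ f n) (ℤₚ.*-identityˡ (f n))

      K0 : ∀ n → K 0ℤ n ≡ 0ℤ
      K0 zero    = refl
      K0 (suc n) = refl

    isCommutativeRing : IsCommutativeRing _≋_ _⊕_ _⊛_ ⊖_ (K 0ℤ) (K 1ℤ)
    isCommutativeRing = record
      { isRing = record
        { +-isAbelianGroup = record
          { isGroup = record
            { isMonoid = record
              { isSemigroup = record
                { isMagma = record
                  { isEquivalence = record
                    { refl = λ n → ~-refl ; sym = λ p n → ~-sym (p n)
                    ; trans = λ p q n → ~-trans (p n) (q n) }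
                  ; ∙-cong = λ p q n → +-cong (p n) (q n) }
                ; assoc = λ f g h → ≡⇒≋ λ n → ℤₚ.+-assoc (f n) (g n) (h n) }
              ; identity = (λ f → ≡⇒≋ λ n → trans (cong (_+ f n) (K0 n)) (ℤₚ.+-identityˡ (f n)))
                         , (λ f → ≡⇒≋ λ n → trans (cong (λ z → f n + z) (K0 n)) (ℤₚ.+-identityʳ (f n))) }
            ; inverse = (λ f → ≡⇒≋ λ n → trans (ℤₚ.+-inverseˡ (f n)) (sym (K0 n)))
                      , (λ f → ≡⇒≋ λ n → trans (ℤₚ.+-inverseʳ (f n)) (sym (K0 n)))
            ; ⁻¹-cong = λ p n → -‿cong (p n) }
          ; comm = λ f g → ≡⇒≋ λ n → ℤₚ.+-comm (f n) (g n) }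
        ; *-cong = ⊛-cong
        ; *-assoc = λ f g h → ≡⇒≋ (⊛-assoc f g h)
        ; *-identity = (λ f → ≡⇒≋ (⊛-identityˡ f))
                     , (λ f → ≡⇒≋ λ n → trans (⊛-comm f (K 1ℤ) n) (⊛-identityˡ f n))
        ; distrib = (λ h f g → ≡⇒≋ λ n → trans (⊛-comm h (f ⊕ g) n)
                       (trans (⊛-distribʳ h f g n) (cong₂ _+_ (⊛-comm f h n) (⊛-comm g h n))))
                  , (λ h f g → ≡⇒≋ (⊛-distribʳ h f g)) }
      ; *-comm = λ f g → ≡⇒≋ (⊛-comm f g) }

    commutativeRing : CommutativeRing 0ℓ 0ℓ
    commutativeRing = record { isCommutativeRing = isCommutativeRing }

    K-+ : ∀ c d → K (c + d) ≋ K c ⊕ K d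
    K-+ c d = ≡⇒≋ λ { zero → refl ; (suc n) → refl }

    K-* : ∀ c d → K (c * d) ≋ K c ⊛ K d
    K-* c d = ≡⇒≋ λ n → trans (K*≡• n) (sym (K-⊛ c (K d) n))
      where
      K*≡• : ∀ n → K (c * d) n ≡ c * K d n
      K*≡• zero    = refl
      K*≡• (suc n) = sym (ℤₚ.*-zeroʳ c)

    K-neg : ∀ c → K (- c) ≋ ⊖ K c
    K-neg c = ≡⇒≋ λ { zero → refl ; (suc n) → refl }

    θ-cong : ∀ {f g} → f ≋ g → θ f ≋ θ g
    θ-cong p n = *-cong {+ n} ~-refl (p n)

    θ-+ : ∀ f g → θ (f ⊕ g) ≋ θ f ⊕ θ g
    θ-+ f g = ≡⇒≋ λ n → ℤₚ.*-distribˡ-+ (+ n) (f n) (g n)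

    θ-* : ∀ f g → θ (f ⊛ g) ≋ θ f ⊛ g ⊕ f ⊛ θ g
    θ-* f g = ≡⇒≋ (θ-⊛ f g)

    θ-K : ∀ c → θ (K c) ≋ K 0ℤ
    θ-K c = ≡⇒≋ λ { zero → ℤₚ.*-zeroˡ c ; (suc n) → ℤₚ.*-zeroʳ (+ suc n) }

    -- The constant coefficient gives f 0 ~ 0, after which the tail of `f` satisfies the same
    -- hypothesis.
    ⊛-zero-cancelʳ : ∀ {h} → h 0 ≡ 1ℤ → ∀ f → f ⊛ h ≋ K 0ℤ → f ≋ K 0ℤ
    ⊛-zero-cancelʳ {h} h0 f p zero =
      ~-trans (~-reflexive (sym (trans (cong (f 0 *_) h0) (ℤₚ.*-identityʳ (f 0))))) (p 0)
    ⊛-zero-cancelʳ {h} h0 f p (suc n) = ~-trans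
      (⊛-zero-cancelʳ h0 (f ∘ suc) (λ i → ~-trans
          (~-trans (~-reflexive (sym (ℤₚ.+-identityˡ _)))
            (+-cong (~-trans (~-reflexive (sym (ℤₚ.*-zeroˡ (h (suc i)))))
                       (*-cong (~-sym (⊛-zero-cancelʳ h0 f p 0)) ~-refl)) ~-refl))
          (~-trans (p (suc i)) (~-reflexive (sym (K0 i)))))
        n)
      (~-reflexive (K0 n))

  module ≡-Series = SeriesRing _≡_ isEquivalence (cong₂ _+_) (cong₂ _*_)

  infix 4 _≡₇_
  record _≡₇_ (x y : ℤ) : Set where
    constructor mod₇
    field
      quotient : ℤ
      equality : x ≡ y + + 7 * quotient

  ≡₇-isEquivalence : IsEquivalence _≡₇_
  ≡₇-isEquivalence = record
    { refl  = λ {x} → mod₇ 0ℤ (sym (ℤₚ.+-identityʳ x))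
    ; sym   = λ { {y = y} (mod₇ k refl) → mod₇ (- k)
        (solve 2 (λ y k → y := (y :+ con (+ 7) :* k) :+ con (+ 7) :* (:- k)) refl y k) }
    ; trans = λ { {k = z} (mod₇ k refl) (mod₇ l refl) → mod₇ (l + k)
        (solve 3 (λ z k l → (z :+ con (+ 7) :* l) :+ con (+ 7) :* k :=
                           z :+ con (+ 7) :* (l :+ k)) refl z k l) } }
    where open +-*-Solver

  ≡₇-+-cong : ∀ {x y u v} → x ≡₇ y → u ≡₇ v → x + u ≡₇ y + v
  ≡₇-+-cong {y = y} {v = v} (mod₇ k refl) (mod₇ l refl) = mod₇ (k + l)
    (solve 4 (λ y v k l → (y :+ con (+ 7) :* k) :+ (v :+ con (+ 7) :* l) :=
                         (y :+ v) :+ con (+ 7) :* (k :+ l)) refl y v k l)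
    where open +-*-Solver

  ≡₇-*-cong : ∀ {x y u v} → x ≡₇ y → u ≡₇ v → x * u ≡₇ y * v
  ≡₇-*-cong {y = y} {v = v} (mod₇ k refl) (mod₇ l refl) = mod₇ (k * v + y * l + + 7 * k * l)
    (solve 4 (λ y v k l → (y :+ con (+ 7) :* k) :* (v :+ con (+ 7) :* l) :=
      y :* v :+ con (+ 7) :* (k :* v :+ y :* l :+ con (+ 7) :* k :* l)) refl y v k l)
    where open +-*-Solver

  module ₇-Series = SeriesRing _≡₇_ ≡₇-isEquivalence ≡₇-+-cong ≡₇-*-cong

-- Differential algebra of the level 2 equations, in general and in characteristic 7

module DifferentialAlgebra where

  open import Algebra using (CommutativeRing; RawRing)
  import Algebra.Solver.Ring
  open import Algebra.Solver.Ring.AlmostCommutativeRing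
    using (fromCommutativeRing; _-Raw-AlmostCommutative⟶_)
  import Algebra.Properties.Group
  open import Data.Maybe as Maybe using (Maybe)
  open import Relation.Nullary.Decidable using (dec⇒maybe)
  open import Level using (0ℓ)
  import Relation.Binary.PropositionalEquality as ≡
  open ≡ using (_≡_)

  -- Kept abstract so that the ring solvers meet opaque elements instead of unfolding series, and so
  -- that the same algebra serves both the exact and the mod 7 series.
  record DifferentialRing : Set₁ where
    field
      baseRing : CommutativeRing 0ℓ 0ℓ
    open CommutativeRing baseRing public
    field
      ι      : ℤ → Carrier
      ι-+    : ∀ c d → ι (c ℤ.+ d) ≈ ι c + ι d
      ι-*    : ∀ c d → ι (c ℤ.* d) ≈ ι c * ι d
      ι-neg  : ∀ c → ι (ℤ.- c) ≈ - ι c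
      ι-0    : ι 0ℤ ≈ 0#
      ι-1    : ι 1ℤ ≈ 1#
      ∂      : Carrier → Carrier
      ∂-cong : ∀ {x y} → x ≈ y → ∂ x ≈ ∂ y
      ∂-+    : ∀ x y → ∂ (x + y) ≈ ∂ x + ∂ y
      ∂-*    : ∀ x y → ∂ (x * y) ≈ ∂ x * y + x * ∂ y
      ∂-ι    : ∀ c → ∂ (ι c) ≈ 0#

  module DifferentialProperties (R : DifferentialRing) where
    open DifferentialRing R public
    open Algebra.Properties.Group +-group public using (∙-cancelʳ)

    private
      morphism : CommutativeRing.rawRing ℤₚ.+-*-commutativeRing -Raw-AlmostCommutative⟶ fromCommutativeRing baseRing
      morphism = record
        { ⟦_⟧ = ι ; +-homo = ι-+ ; *-homo = ι-* ; -‿homo = ι-neg ; 0-homo = ι-0 ; 1-homo = ι-1 }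

      coefficient≟ : ∀ c d → Maybe (ι c ≈ ι d)
      coefficient≟ c d = Maybe.map (λ { ≡.refl → refl }) (dec⇒maybe (c ℤ.≟ d))

    module ℤ-Solver = Algebra.Solver.Ring _ (fromCommutativeRing baseRing) morphism coefficient≟

    open import Relation.Binary.Reasoning.Setoid setoid

    -- A certificate of ideal membership: the last premise says x - y = c(l - r) without
    -- subtraction, and the solver can check it as a pure polynomial identity. The cofactor `c` is
    -- the only thing to be found.
    lin₁ : ∀ {x y l r} c → l ≈ r → x + c * r ≈ y + c * l → x ≈ y
    lin₁ {x} {y} {l} {r} c l≈r p =
      ∙-cancelʳ (c * r) x y (trans p (+-congˡ (*-congˡ l≈r)))

    lin₂ : ∀ {x y l r l′ r′} c c′ → l ≈ r → l′ ≈ r′ →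
           x + (c * r + c′ * r′) ≈ y + (c * l + c′ * l′) → x ≈ y
    lin₂ c c′ l≈r l′≈r′ p =
      ∙-cancelʳ _ _ _ (trans p (+-congˡ (+-cong (*-congˡ l≈r) (*-congˡ l′≈r′))))

    lin₃ : ∀ {x y l r l′ r′ l″ r″} c c′ c″ → l ≈ r → l′ ≈ r′ → l″ ≈ r″ →
           x + (c * r + c′ * r′ + c″ * r″) ≈ y + (c * l + c′ * l′ + c″ * l″) → x ≈ y
    lin₃ c c′ c″ l≈r l′≈r′ l″≈r″ p =
      ∙-cancelʳ _ _ _ (trans p (+-congˡ (+-cong (+-cong (*-congˡ l≈r) (*-congˡ l′≈r′)) (*-congˡ l″≈r″))))

    ∂-log-* : ∀ {x y s t} → ∂ x ≈ s * x → ∂ y ≈ t * y → ∂ (x * y) ≈ (s + t) * (x * y)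
    ∂-log-* {x} {y} {s} {t} p q = begin
      ∂ (x * y)                  ≈⟨ ∂-* x y ⟩
      ∂ x * y + x * ∂ y          ≈⟨ +-cong (*-congʳ p) (*-congˡ q) ⟩
      s * x * y + x * (t * y)    ≈⟨ solve 4 (λ x y s t → s :* x :* y :+ x :* (t :* y) :=
                                      (s :+ t) :* (x :* y)) refl x y s t ⟩
      (s + t) * (x * y)          ∎
      where open ℤ-Solver

    ∂-ι* : ∀ c x → ∂ (ι c * x) ≈ ι c * ∂ x
    ∂-ι* c x = begin
      ∂ (ι c * x)              ≈⟨ ∂-* (ι c) x ⟩
      ∂ (ι c) * x + ι c * ∂ x  ≈⟨ +-congʳ (trans (*-congʳ (∂-ι c)) (zeroˡ x)) ⟩
      0# + ι c * ∂ x           ≈⟨ +-identityˡ _ ⟩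
      ι c * ∂ x                ∎

    ∂-neg : ∀ x → ∂ (- x) ≈ - ∂ x
    ∂-neg x = begin
      ∂ (- x)              ≈⟨ ∂-cong (solve 1 (λ x → :- x := con ℤ.-1ℤ :* x) refl x) ⟩
      ∂ (ι ℤ.-1ℤ * x)      ≈⟨ ∂-ι* ℤ.-1ℤ x ⟩
      ι ℤ.-1ℤ * ∂ x        ≈⟨ solve 1 (λ x → con ℤ.-1ℤ :* x := :- x) refl (∂ x) ⟩
      - ∂ x                ∎
      where open ℤ-Solver

    ∂-² : ∀ x → ∂ (x * x) ≈ ι (+ 2) * (x * ∂ x)
    ∂-² x = trans (∂-* x x)
      (solve 2 (λ x y → y :* x :+ x :* y := con (+ 2) :* (x :* y)) refl x (∂ x))
      where open ℤ-Solver

    ∂-³ : ∀ x → ∂ (x * x * x) ≈ ι (+ 3) * (x * x * ∂ x)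
    ∂-³ x = begin
      ∂ (x * x * x)                          ≈⟨ ∂-* (x * x) x ⟩
      ∂ (x * x) * x + x * x * ∂ x            ≈⟨ +-congʳ (*-congʳ (∂-² x)) ⟩
      ι (+ 2) * (x * ∂ x) * x + x * x * ∂ x  ≈⟨ solve 2 (λ x y → con (+ 2) :* (x :* y) :* x :+
                                                  x :* x :* y := con (+ 3) :* (x :* x :* y)) refl x (∂ x) ⟩
      ι (+ 3) * (x * x * ∂ x)                ∎
      where open ℤ-Solver

    ∂∂-* : ∀ x y → ∂ (∂ (x * y)) ≈ ∂ (∂ x) * y + ι (+ 2) * (∂ x * ∂ y) + x * ∂ (∂ y)
    ∂∂-* x y = begin
      ∂ (∂ (x * y))                      ≈⟨ ∂-cong (∂-* x y) ⟩
      ∂ (∂ x * y + x * ∂ y)              ≈⟨ ∂-+ (∂ x * y) (x * ∂ y) ⟩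
      ∂ (∂ x * y) + ∂ (x * ∂ y)          ≈⟨ +-cong (∂-* (∂ x) y) (∂-* x (∂ y)) ⟩
      (∂ (∂ x) * y + ∂ x * ∂ y) + (∂ x * ∂ y + x * ∂ (∂ y))
        ≈⟨ solve 3 (λ a b c → (a :+ b) :+ (b :+ c) := a :+ con (+ 2) :* b :+ c) refl
             (∂ (∂ x) * y) (∂ x * ∂ y) (x * ∂ (∂ y)) ⟩
      ∂ (∂ x) * y + ι (+ 2) * (∂ x * ∂ y) + x * ∂ (∂ y) ∎
      where open ℤ-Solver

    infixl 8 _³ _⁷ _⁸
    _³ _⁷ _⁸ : Carrier → Carrier
    x ³ = x * x * x
    x ⁷ = x * x * (x * x) * (x * x) * x
    x ⁸ = x * x * (x * x) * (x * x * (x * x))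

    module LevelTwo {e P Q : Carrier}
      (∂e : ι (+ 2) * ∂ e ≈ e * P - Q) (∂Q : ∂ Q ≈ (P - e) * Q) where
      open ℤ-Solver

      B : Carrier
      B = Q * (e * e - Q)

      -- Both factors have a logarithmic derivative: P - e for `Q`, and P for e² - Q, because 2e∂e
      -- contributes e²P - eQ, whose last term cancels against -(P - e)Q.
      ∂B : ∂ B ≈ (ι (+ 2) * P - e) * B
      ∂B = begin
        ∂ B                          ≈⟨ ∂-log-* ∂Q ∂X ⟩
        (P - e + P) * B              ≈⟨ *-congʳ (solve 2 (λ P e → P :- e :+ P := con (+ 2) :* P :- e) refl P e) ⟩
        (ι (+ 2) * P - e) * B        ∎
        where
        ∂X : ∂ (e * e - Q) ≈ P * (e * e - Q)
        ∂X = begin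
          ∂ (e * e - Q)        ≈⟨ ∂-+ (e * e) (- Q) ⟩
          ∂ (e * e) + ∂ (- Q)  ≈⟨ +-cong (∂-² e) (trans (∂-neg Q) (-‿cong ∂Q)) ⟩
          ι (+ 2) * (e * ∂ e) - (P - e) * Q
            ≈⟨ lin₁ e ∂e (solve 4 (λ e P Q d →
                 con (+ 2) :* (e :* d) :- (P :- e) :* Q :+ e :* (e :* P :- Q) :=
                 P :* (e :* e :- Q) :+ e :* (con (+ 2) :* d)) refl e P Q (∂ e)) ⟩
          P * (e * e - Q)      ∎

      -- The logarithmic derivatives are 8S for A⁸ and, by `M`, 1 - 8S for `B`; they add up to 1.
      ∂[A⁸B] : ∀ {A S} → ∂ A ≈ S * A → ι (+ 2) * P - e ≈ ι 1ℤ - ι (+ 8) * S → ∂ (A ⁸ * B) ≈ A ⁸ * B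
      ∂[A⁸B] {A} {S} ∂A M = begin
        ∂ (A ⁸ * B)
          ≈⟨ ∂-log-* (∂-log-* ∂A⁴ ∂A⁴) ∂B ⟩
        ((S + S + (S + S)) + (S + S + (S + S)) + (ι (+ 2) * P - e)) * (A ⁸ * B)
          ≈⟨ *-congʳ (lin₁ (ι 1ℤ) M (solve 3 (λ S P e →
               S :+ S :+ (S :+ S) :+ (S :+ S :+ (S :+ S)) :+ (con (+ 2) :* P :- e)
                 :+ con 1ℤ :* (con 1ℤ :- con (+ 8) :* S) :=
               con 1ℤ :+ con 1ℤ :* (con (+ 2) :* P :- e)) refl S P e)) ⟩
        ι 1ℤ * (A ⁸ * B)
          ≈⟨ trans (*-congʳ ι-1) (*-identityˡ _) ⟩
        A ⁸ * B ∎
        where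
        ∂A⁴ = ∂-log-* (∂-log-* ∂A ∂A) (∂-log-* ∂A ∂A)

  module Characteristic7 (R : DifferentialRing)
    (ι-7 : DifferentialRing._≈_ R (DifferentialRing.ι R (+ 7)) (DifferentialRing.0# R)) where

    open DifferentialProperties R public
    open import Relation.Binary.Reasoning.Setoid setoid

    private
      ι-%7 : ∀ m → ι (+ (m % 7)) ≈ ι (+ m)
      ι-%7 m = begin
        ι (+ (m % 7))                                 ≈⟨ +-identityʳ _ ⟨
        ι (+ (m % 7)) + 0#                            ≈⟨ +-congˡ (trans (*-congˡ ι-7) (zeroʳ _)) ⟨
        ι (+ (m % 7)) + ι (+ (m ℕ./ 7)) * ι (+ 7)     ≈⟨ +-congˡ (ι-* (+ (m ℕ./ 7)) (+ 7)) ⟨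
        ι (+ (m % 7)) + ι (+ (m ℕ./ 7) ℤ.* + 7)       ≈⟨ ι-+ (+ (m % 7)) _ ⟨
        ι (+ (m % 7) ℤ.+ + (m ℕ./ 7) ℤ.* + 7)
          ≡⟨ ≡.cong (λ z → ι (+ (m % 7) ℤ.+ z)) (ℤₚ.pos-* (m ℕ./ 7) 7) ⟨
        ι (+ (m % 7 ℕ.+ m ℕ./ 7 ℕ.* 7))               ≡⟨ ≡.cong (λ z → ι (+ z)) (DivMod.m≡m%n+[m/n]*n m 7) ⟨
        ι (+ m)                                       ∎

      -- Reduced residues as coefficients: the solver brings every constant to normal form modulo 7,
      -- so identities true only in characteristic 7 are proved by `refl`.
      ℤ/7 : RawRing 0ℓ 0ℓ
      ℤ/7 = record
        { Carrier = ℕ ; _≈_ = _≡_ ; _+_ = λ m n → (m ℕ.+ n) % 7 ; _*_ = λ m n → (m ℕ.* n) % 7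
        ; -_ = λ m → (6 ℕ.* m) % 7 ; 0# = 0 ; 1# = 1 }

      morphism : ℤ/7 -Raw-AlmostCommutative⟶ fromCommutativeRing baseRing
      morphism = record
        { ⟦_⟧    = λ m → ι (+ m)
        ; +-homo = λ m n → trans (ι-%7 (m ℕ.+ n)) (ι-+ (+ m) (+ n))
        ; *-homo = λ m n → trans (ι-%7 (m ℕ.* n))
                     (trans (reflexive (≡.cong ι (ℤₚ.pos-* m n))) (ι-* (+ m) (+ n)))
        ; -‿homo = λ m → trans (ι-%7 (6 ℕ.* m)) (neg m)
        ; 0-homo = ι-0
        ; 1-homo = ι-1 }
        where
        neg : ∀ m → ι (+ (6 ℕ.* m)) ≈ - ι (+ m)
        neg m = begin
          ι (+ (6 ℕ.* m))                        ≡⟨ ≡.cong ι (ℤₚ.pos-* 6 m) ⟩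
          ι (+ 6 ℤ.* + m)                        ≈⟨ ι-* (+ 6) (+ m) ⟩
          ι (+ 6) * ι (+ m)                      ≈⟨ solve 1 (λ x → con (+ 6) :* x :=
                                                      con (+ 7) :* x :- x) refl (ι (+ m)) ⟩
          ι (+ 7) * ι (+ m) - ι (+ m)            ≈⟨ +-congʳ (trans (*-congʳ ι-7) (zeroˡ _)) ⟩
          0# - ι (+ m)                           ≈⟨ +-identityˡ _ ⟩
          - ι (+ m)                              ∎
          where open ℤ-Solver

      coefficient≟ : ∀ m n → Maybe (ι (+ m) ≈ ι (+ n))
      coefficient≟ m n = Maybe.map (λ { ≡.refl → refl }) (dec⇒maybe (m ℕ.≟ n))

    open Algebra.Solver.Ring ℤ/7 (fromCommutativeRing baseRing) morphism coefficient≟ public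
      using (solve; con; _:=_; _:+_; _:*_; :-_; _:-_; Polynomial)


    module CubicPartitions {e P Q Q₁ A S q : Carrier}
      (∂e : ι (+ 2) * ∂ e ≈ e * P - Q) (∂Q : ∂ Q ≈ (P - e) * Q)
      (e² : ι (+ 4) * (e * e) ≈ Q₁ + ι (+ 3) * Q)
      (E₆ : e * (ι (+ 3) * Q - ι (+ 2) * Q₁) ≈ ι 1ℤ)
      (∂A : ∂ A ≈ S * A) (M : ι (+ 2) * P - e ≈ ι 1ℤ - ι (+ 8) * S)
      (∂q : ∂ q ≈ ι 1ℤ * q)
      (A⁸B : A ⁸ * (Q * (e * e - Q)) ≈ ι (+ 64) * q)
      (w-cancel : ∀ x → (e * e) * x ≈ 0# → x ≈ 0#)
      where

      open LevelTwo ∂e ∂Q using (B; ∂B)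

      -- The exponent 6 is -1/8 modulo 7: `F` stands for q^(-1/8)A, the reciprocal of η(q)η(q²).
      -- Indeed 8 ≡ 1 turns `M` into S = 1 - (2P - e), so that ∂F = (6 + S)F = -(2P - e)F. The
      -- polynomial `φ` is the value that ∂w turns out to have.
      w v g φ F h : Carrier
      w = e * e
      v = w * w * w
      g = v - ι 1ℤ
      φ = ι (+ 2) + ι (+ 5) * v
      F = q * q * (q * q) * (q * q) * A
      h = ∂ F

      private
        cube : ∀ {n} → Polynomial n → Polynomial n
        cube x = x :* x :* x

      -- Substituting Q₁ = 4e² - 3Q into `E₆` gives 9eQ - 8e³ = 1.
      eQ : ι (+ 2) * (e * Q) ≈ ι 1ℤ + e * e * e
      eQ = lin₂ (ι 1ℤ) (ι (+ 5) * e) E₆ e² (solve 3 (λ e Q Q₁ →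
        con 2 :* (e :* Q) :+ (con 1 :* con 1 :+ con 5 :* e :* (Q₁ :+ con 3 :* Q)) :=
        con 1 :+ cube e :+ (con 1 :* (e :* (con 3 :* Q :- con 2 :* Q₁))
          :+ con 5 :* e :* (con 4 :* (e :* e)))) refl e Q Q₁)

      -- Since 4wB = 2eQ(2e³ - 2eQ), `eQ` makes it (1 + e³)(e³ - 1).
      4wB : ι (+ 4) * (w * B) ≈ g
      4wB = lin₁ (e * e * e - ι 1ℤ - ι (+ 2) * (e * Q)) eQ (solve 2 (λ e Q →
        con 4 :* (e :* e :* (Q :* (e :* e :- Q)))
          :+ (cube e :- con 1 :- con 2 :* (e :* Q)) :* (con 1 :+ cube e) :=
        cube (e :* e) :- con 1
          :+ (cube e :- con 1 :- con 2 :* (e :* Q)) :* (con 2 :* (e :* Q))) refl e Q)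

      -- From `∂e`, 2∂w = 2e(eP - Q) = 2wP - 2eQ, and `eQ` replaces 2eQ by 1 + e³.
      wM : w * (ι (+ 2) * P - e) ≈ ι (+ 2) * ∂ w + ι 1ℤ
      wM = lin₃ (ι (+ 5)) (ι (+ 5) * e) (ι 1ℤ) (∂-² e) ∂e eQ (solve 5 (λ e P Q ∂e ∂w →
        e :* e :* (con 2 :* P :- e) :+ (con 5 :* (con 2 :* (e :* ∂e))
          :+ con 5 :* e :* (e :* P :- Q) :+ con 1 :* (con 1 :+ cube e)) :=
        con 2 :* ∂w :+ con 1 :+ (con 5 :* ∂w
          :+ con 5 :* e :* (con 2 :* ∂e) :+ con 1 :* (con 2 :* (e :* Q)))) refl e P Q (∂ e) (∂ w))

      ∂g≈3w²∂w : ∂ g ≈ ι (+ 3) * (w * w * ∂ w)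
      ∂g≈3w²∂w = begin
        ∂ (v - ι 1ℤ)          ≈⟨ ∂-+ v (- ι 1ℤ) ⟩
        ∂ v + ∂ (- ι 1ℤ)      ≈⟨ +-cong (∂-³ w) (trans (∂-neg _) (-‿cong (∂-ι 1ℤ))) ⟩
        ι (+ 3) * (w * w * ∂ w) - 0#
          ≈⟨ +-congˡ (-‿cong ι-0) ⟨
        ι (+ 3) * (w * w * ∂ w) - ι 0ℤ
          ≈⟨ solve 1 (λ x → x :- con 0 := x) refl _ ⟩
        ι (+ 3) * (w * w * ∂ w) ∎

      -- Differentiating 4wB = g and multiplying by w leaves a linear equation for ∂ w.
      ∂w : ∂ w ≈ φ
      ∂w = lin₃ (ι (+ 2) * w) (ι (+ 5) * (∂ w + w * m)) (ι (+ 5) * g) ∂[4wB] 4wB wM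
        (solve 4 (λ w B m d →
          d :+ (con 2 :* w :* (con 3 :* (w :* w :* d)) :+ con 5 :* (d :+ w :* m) :* (cube w :- con 1)
            :+ con 5 :* (cube w :- con 1) :* (con 2 :* d :+ con 1)) :=
          con 2 :+ con 5 :* cube w :+ (con 2 :* w :* (con 4 :* (d :* B :+ w :* (m :* B)))
            :+ con 5 :* (d :+ w :* m) :* (con 4 :* (w :* B))
            :+ con 5 :* (cube w :- con 1) :* (w :* m))) refl w B m (∂ w))
        where
        m = ι (+ 2) * P - e
        ∂[4wB] : ι (+ 4) * (∂ w * B + w * (m * B)) ≈ ι (+ 3) * (w * w * ∂ w)
        ∂[4wB] = begin
          ι (+ 4) * (∂ w * B + w * (m * B))  ≈⟨ *-congˡ (+-congˡ (*-congˡ ∂B)) ⟨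
          ι (+ 4) * (∂ w * B + w * ∂ B)      ≈⟨ *-congˡ (∂-* w B) ⟨
          ι (+ 4) * ∂ (w * B)                ≈⟨ ∂-ι* (+ 4) (w * B) ⟨
          ∂ (ι (+ 4) * (w * B))              ≈⟨ ∂-cong 4wB ⟩
          ∂ g                                ≈⟨ ∂g≈3w²∂w ⟩
          ι (+ 3) * (w * w * ∂ w)            ∎

      -- The equation ∂F = -(2P - e)F still contains P; multiplying by w lets `wM` and `∂w` express
      -- everything through w.
      wh : w * h ≈ (ι (+ 2) + ι (+ 4) * v) * F
      wh = trans (*-congˡ ∂F) (lin₃ (w * F) (ι (+ 6) * F) (ι (+ 5) * F) M wM ∂w
        (solve 5 (λ w m S F d →
          w :* ((con 6 :+ S) :* F) :+ (w :* F :* (con 1 :- con 8 :* S)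
            :+ con 6 :* F :* (con 2 :* d :+ con 1) :+ con 5 :* F :* (con 2 :+ con 5 :* cube w)) :=
          (con 2 :+ con 4 :* cube w) :* F :+ (w :* F :* m
            :+ con 6 :* F :* (w :* m) :+ con 5 :* F :* d)) refl w (ι (+ 2) * P - e) S F (∂ w)))
        where
        ∂F : ∂ F ≈ (ι (+ 6) + S) * F
        ∂F = trans (∂-log-* (∂-log-* (∂-log-* ∂q² ∂q²) ∂q²) ∂A)
          (*-congʳ (solve 1 (λ S → con 1 :+ con 1 :+ (con 1 :+ con 1) :+ (con 1 :+ con 1) :+ S :=
             con 6 :+ S) refl S))
          where ∂q² = ∂-log-* ∂q ∂q

      ∂-affine : ∀ a x → ∂ (ι a + x) ≈ ∂ x
      ∂-affine a x = trans (∂-+ (ι a) x) (trans (+-congʳ (∂-ι a)) (+-identityˡ (∂ x)))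

      ∂v : ∂ v ≈ ι (+ 3) * (w * w * φ)
      ∂v = trans (∂-³ w) (*-congˡ (*-congˡ ∂w))

      -- Read `wh` as h = (2w⁻¹ + 4w²)F. In its derivative the coefficients of w⁻² and of w⁴ are
      -- multiples of 7, and only wF survives. To avoid w⁻¹ the computation is carried out after
      -- multiplication by w², which `w-cancel` removes in two steps.
      ∂h : ∂ h ≈ w * F
      ∂h = lin₁ (ι 1ℤ) (trans (w-cancel _ (w-cancel _ w²[∂h-wF])) (sym ι-0)) (solve 3 (λ w F dh →
          dh :+ con 1 :* con 0 := w :* F :+ con 1 :* (dh :- w :* F)) refl w F (∂ h))
        where
        ∂[wh] : ∂ w * h + w * ∂ h ≈ ι (+ 4) * (ι (+ 3) * (w * w * φ)) * F + (ι (+ 2) + ι (+ 4) * v) * h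
        ∂[wh] = begin
          ∂ w * h + w * ∂ h     ≈⟨ ∂-* w h ⟨
          ∂ (w * h)             ≈⟨ ∂-cong wh ⟩
          ∂ ((ι (+ 2) + ι (+ 4) * v) * F) ≈⟨ ∂-* _ F ⟩
          ∂ (ι (+ 2) + ι (+ 4) * v) * F + (ι (+ 2) + ι (+ 4) * v) * h
            ≈⟨ +-congʳ (*-congʳ (trans (trans (∂-affine (+ 2) _) (∂-ι* (+ 4) v)) (*-congˡ ∂v))) ⟩
          ι (+ 4) * (ι (+ 3) * (w * w * φ)) * F + (ι (+ 2) + ι (+ 4) * v) * h ∎
        w²[∂h-wF] : w * (w * (∂ h - w * F)) ≈ 0#
        w²[∂h-wF] = trans (lin₃ w (ι (+ 2) + ι (+ 4) * v - ∂ w) (ι (+ 6) * (ι (+ 2) + ι (+ 4) * v) * F) ∂[wh] wh ∂w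
          (solve 5 (λ w F h d dh → let s = con 2 :+ con 4 :* cube w ; φ = con 2 :+ con 5 :* cube w in
            w :* (w :* (dh :- w :* F)) :+ (w :* (con 4 :* (con 3 :* (w :* w :* φ)) :* F :+ s :* h)
              :+ (s :- d) :* (s :* F) :+ con 6 :* s :* F :* φ) :=
            con 0 :+ (w :* (d :* h :+ w :* dh) :+ (s :- d) :* (w :* h) :+ con 6 :* s :* F :* d))
            refl w F h (∂ w) (∂ h))) ι-0

      ∂²h : ∂ (∂ h) ≈ (ι (+ 4) + ι (+ 2) * v) * F
      ∂²h = trans (∂-cong ∂h) (trans (∂-* w F) (lin₂ F (ι 1ℤ) ∂w wh (solve 4 (λ w F h d →
        let v = cube w in
        d :* F :+ w :* h :+ (F :* (con 2 :+ con 5 :* v) :+ con 1 :* ((con 2 :+ con 4 :* v) :* F)) :=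
        (con 4 :+ con 2 :* v) :* F :+ (F :* d :+ con 1 :* (w :* h))) refl w F h (∂ w))))

      ∂²w : ∂ (∂ w) ≈ ι (+ 5) * (ι (+ 3) * (w * w * φ))
      ∂²w = trans (∂-cong ∂w) (trans (trans (∂-affine (+ 2) _) (∂-ι* (+ 5) v)) (*-congˡ ∂v))

      p p′ : Carrier
      p  = w * w * (ι (+ 2) + ι (+ 3) * v)
      p′ = w * (ι 1ℤ + v * (ι 1ℤ + ι (+ 5) * v))

      -- Leibniz applied to wF leaves the term 2φh. Only wh, not h itself, is known as a polynomial
      -- multiple of F, so 2φh is split as 4h + 3w²(wh) and 4h is kept.
      ∂³h : ∂ (∂ (∂ h)) ≈ p * F + ι (+ 4) * h
      ∂³h = trans (∂-cong (∂-cong ∂h)) (trans (∂∂-* w F) (trans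
        (+-cong (+-cong (*-congʳ ∂²w) (*-congˡ (*-congʳ ∂w))) (*-congˡ ∂h))
        (lin₁ (ι (+ 3) * (w * w)) wh (solve 3 (λ w F h →
          let v = cube w ; φ = con 2 :+ con 5 :* v in
          con 5 :* (con 3 :* (w :* w :* φ)) :* F :+ con 2 :* (φ :* h) :+ w :* (w :* F)
            :+ con 3 :* (w :* w) :* ((con 2 :+ con 4 :* v) :* F) :=
          w :* w :* (con 2 :+ con 3 :* v) :* F :+ con 4 :* h
            :+ con 3 :* (w :* w) :* (w :* h)) refl w F h))))

      ∂p : ∂ p ≈ p′
      ∂p = trans (∂-* (w * w) _) (trans
        (+-cong (*-congʳ (trans (∂-² w) (*-congˡ (*-congˡ ∂w))))
                (*-congˡ (trans (trans (∂-affine (+ 2) _) (∂-ι* (+ 3) v)) (*-congˡ ∂v))))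
        (solve 1 (λ w → let v = cube w ; φ = con 2 :+ con 5 :* v in
          con 2 :* (w :* φ) :* (con 2 :+ con 3 :* v) :+ w :* w :* (con 3 :* (con 3 :* (w :* w :* φ))) :=
          w :* (con 1 :+ v :* (con 1 :+ con 5 :* v))) refl w))

      ∂²p : ∂ (∂ p) ≈ ι (+ 2) + ι (+ 6) * v + ι (+ 6) * (v * v)
      ∂²p = trans (∂-cong ∂p) (trans (∂-* w _) (trans
        (+-cong (*-congʳ ∂w) (*-congˡ (trans (∂-affine 1ℤ _) (trans (∂-* v _)
          (+-cong (*-congʳ ∂v) (*-congˡ (trans (trans (∂-affine 1ℤ _) (∂-ι* (+ 5) v)) (*-congˡ ∂v))))))))
        (solve 1 (λ w → let v = cube w ; φ = con 2 :+ con 5 :* v ; v′ = con 3 :* (w :* w :* φ) in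
          φ :* (con 1 :+ v :* (con 1 :+ con 5 :* v)) :+ w :* (v′ :* (con 1 :+ con 5 :* v) :+ v :* (con 5 :* v′)) :=
          con 2 :+ con 6 :* v :+ con 6 :* (v :* v)) refl w)))

      -- The remaining h disappears: 2∂p·h carries a factor w because `p′` does, so `wh` applies,
      -- and 4∂²h is already a multiple of F.
      ∂⁵h : ∂ (∂ (∂ (∂ (∂ h)))) ≈ (ι 1ℤ + ι (+ 2) * (v * v) + ι (+ 5) * (v * v * v)) * F
      ∂⁵h = trans (∂-cong (∂-cong ∂³h)) (trans (∂-cong (∂-+ _ _)) (trans (∂-+ _ _) (trans
        (+-cong (trans (∂∂-* p F) (+-cong (+-cong (*-congʳ ∂²p) (*-congˡ (*-congʳ ∂p))) (*-congˡ ∂h)))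
                (trans (∂-cong (∂-ι* (+ 4) h)) (trans (∂-ι* (+ 4) (∂ h)) (*-congˡ ∂²h))))
        (lin₁ (ι (+ 2) * (ι 1ℤ + v * (ι 1ℤ + ι (+ 5) * v))) wh (solve 3 (λ w F h →
          let v = cube w ; r = con 1 :+ v :* (con 1 :+ con 5 :* v) in
          (con 2 :+ con 6 :* v :+ con 6 :* (v :* v)) :* F :+ con 2 :* (w :* r :* h)
            :+ w :* w :* (con 2 :+ con 3 :* v) :* (w :* F) :+ con 4 :* ((con 4 :+ con 2 :* v) :* F)
            :+ con 2 :* r :* ((con 2 :+ con 4 :* v) :* F) :=
          (con 1 :+ con 2 :* (v :* v) :+ con 5 :* (v :* v :* v)) :* F
            :+ con 2 :* r :* (w :* h)) refl w F h)))))

      -- Multiply `4wB` by A⁸ and use `A⁸B`, where 64 ≡ 1.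
      4wq : ι (+ 4) * (w * q) ≈ g * A ⁸
      4wq = lin₂ (ι (+ 3) * w) (A ⁸) A⁸B 4wB (solve 5 (λ w B q A⁸ g →
        con 4 :* (w :* q) :+ (con 3 :* w :* (con 64 :* q) :+ A⁸ :* g) :=
        g :* A⁸ :+ (con 3 :* w :* (A⁸ :* B) :+ A⁸ :* (con 4 :* (w :* B)))) refl w B q (A ⁸) g)

      A⁷[F-∂⁶F] : A ⁷ * (F - ∂ (∂ (∂ (∂ (∂ h))))) ≈ (w * q) ⁷
      A⁷[F-∂⁶F] = trans (*-congˡ (+-congˡ (-‿cong ∂⁵h)))
        (lin₁ (ι (+ 5) * (v * v) * (q * q * (q * q) * (q * q))) 4wq (solve 3 (λ w A q →
          let v = cube w ; q⁶ = q :* q :* (q :* q) :* (q :* q) ; x = w :* q in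
          A :* A :* (A :* A) :* (A :* A) :* A :* (q⁶ :* A :- (con 1 :+ con 2 :* (v :* v)
              :+ con 5 :* (v :* v :* v)) :* (q⁶ :* A))
            :+ con 5 :* (v :* v) :* q⁶ :* ((v :- con 1) :* (A :* A :* (A :* A) :* (A :* A :* (A :* A)))) :=
          x :* x :* (x :* x) :* (x :* x) :* x
            :+ con 5 :* (v :* v) :* q⁶ :* (con 4 :* (w :* q))) refl w A q))

      ∂g : ∂ g ≈ w * w * g
      ∂g = trans ∂g≈3w²∂w (trans (*-congˡ (*-congˡ ∂w)) (solve 1 (λ w →
        con 3 :* (w :* w :* (con 2 :+ con 5 :* cube w)) := w :* w :* (cube w :- con 1)) refl w))

      ∂²g : ∂ (∂ g) ≈ ι (+ 4) * (w * (ι 1ℤ + v)) * g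
      ∂²g = trans (∂-cong ∂g) (trans (∂-* (w * w) g) (trans
        (+-cong (*-congʳ (trans (∂-² w) (*-congˡ (*-congˡ ∂w)))) (*-congˡ ∂g))
        (solve 1 (λ w → let v = cube w ; φ = con 2 :+ con 5 :* v ; g = v :- con 1 in
          con 2 :* (w :* φ) :* g :+ w :* w :* (w :* w :* g) := con 4 :* (w :* (con 1 :+ v)) :* g) refl w)))

      -- Leibniz gives g the coefficient 8 + 56v + 84v², which is 1 modulo 7.
      ∂³g : ∂ (∂ (∂ g)) ≈ g
      ∂³g = trans (∂-cong ∂²g) (trans (∂-* _ g) (trans
        (+-cong (*-congʳ (trans (∂-ι* (+ 4) _) (*-congˡ (trans (∂-* w _)
                   (+-cong (*-congʳ ∂w) (*-congˡ (trans (∂-affine 1ℤ v) ∂v)))))))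
                (*-congˡ ∂g))
        (solve 1 (λ w → let v = cube w ; φ = con 2 :+ con 5 :* v ; g = v :- con 1 in
          con 4 :* (φ :* (con 1 :+ v) :+ w :* (con 3 :* (w :* w :* φ))) :* g
            :+ con 4 :* (w :* (con 1 :+ v)) :* (w :* w :* g) := g) refl w)))

      ∂A⁷ : ∂ (A ⁷) ≈ 0#
      ∂A⁷ = trans (∂-log-* (∂-log-* (∂-log-* ∂A² ∂A²) ∂A²) ∂A) (trans (*-congʳ (trans
          (solve 1 (λ S → S :+ S :+ (S :+ S) :+ (S :+ S) :+ S := con 0) refl S) ι-0)) (zeroˡ _))
        where ∂A² = ∂-log-* ∂A ∂A

      ∂-*A⁷ : ∀ x → ∂ (x * A ⁷) ≈ ∂ x * A ⁷
      ∂-*A⁷ x = trans (∂-* x (A ⁷)) (trans (+-congˡ (trans (*-congˡ ∂A⁷) (zeroʳ x))) (+-identityʳ _))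

      ∂³[gA⁷] : ∂ (∂ (∂ (g * A ⁷))) ≈ g * A ⁷
      ∂³[gA⁷] = trans (∂-cong (trans (∂-cong (∂-*A⁷ g)) (∂-*A⁷ (∂ g)))) (trans (∂-*A⁷ (∂ (∂ g))) (*-congʳ ∂³g))

      4C : ∀ {C} → A * C ≈ w * q → (ι (+ 4) * C - g * A ⁷) * A ≈ 0#
      4C {C} AC = trans (lin₂ (ι (+ 4)) (ι 1ℤ) AC 4wq (solve 5 (λ w q A C g →
          (con 4 :* C :- g :* (A :* A :* (A :* A) :* (A :* A) :* A)) :* A :+ (con 4 :* (w :* q)
            :+ con 1 :* (g :* (A :* A :* (A :* A) :* (A :* A :* (A :* A))))) :=
          con 0 :+ (con 4 :* (A :* C) :+ con 1 :* (con 4 :* (w :* q)))) refl w q A C g)) ι-0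

-- Lambert series and their products

module LambertSeries where

  open FiniteSums
  open PowerSeries
  open import Data.Integer using (-_; _+_; _*_; _-_)
  open import Data.Integer.Solver using (module +-*-Solver)
  open import Relation.Binary.PropositionalEquality hiding ([_])

  lambertBox : ℕ → (ℕ → ℕ → ℤ) → Series
  lambertBox N F n = Σ< N λ a → Σ< N λ x → δ (suc a ℕ.* suc x) n * F (suc a) (suc x)

  lambert : (ℕ → ℕ → ℤ) → Series
  lambert F n = lambertBox n F n

  -- In `lambert` the cut-off varies with the coefficient; a product needs one cut-off for all
  -- coefficients up to `n`.
  lambert-box : ∀ {n N} F → n ℕ.≤ N → lambert F n ≡ lambertBox N F n
  lambert-box {n} {N} F n≤N = sym (trans
    (Σ-cong N λ a → Σ-extend _ n≤N λ x n≤x → 0*≡0 _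
       (δ-> (ℕₚ.≤-trans (s≤s n≤x) (ℕₚ.m≤n*m (suc x) (suc a)))))
    (Σ-extend _ n≤N λ a n≤a → Σ-vanish n λ x → 0*≡0 _
       (δ-> (ℕₚ.≤-trans (s≤s n≤a) (ℕₚ.m≤m*n (suc a) (suc x))))))

  lambert-cong : ∀ {F G} → (∀ a x → F (suc a) (suc x) ≡ G (suc a) (suc x)) →
                 ∀ n → lambert F n ≡ lambert G n
  lambert-cong F≗G n = Σ²-cong n n λ a x → cong (δ (suc a ℕ.* suc x) n *_) (F≗G a x)

  lambert-+ : ∀ F G n → lambert (λ a x → F a x + G a x) n ≡ lambert F n + lambert G n
  lambert-+ F G n = trans
    (Σ²-cong n n λ a x → ℤₚ.*-distribˡ-+ (δ (suc a ℕ.* suc x) n) (F (suc a) (suc x)) (G (suc a) (suc x)))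
    (Σ²-+ n n _ _)

  lambert-* : ∀ c F n → lambert (λ a x → c * F a x) n ≡ c * lambert F n
  lambert-* c F n = trans
    (Σ²-cong n n λ a x → solve 3 (λ d c f → d :* (c :* f) := c :* (d :* f)) refl
       (δ (suc a ℕ.* suc x) n) c (F (suc a) (suc x)))
    (Σ²-* n n c _)
    where open +-*-Solver

  θ-lambert : ∀ F n → θ (lambert F) n ≡ lambert (λ a x → + a * + x * F a x) n
  θ-lambert F n = trans (sym (lambert-* (+ n) F n)) (Σ²-cong n n λ a x →
    trans (sym (δ-subst (suc a ℕ.* suc x) n (λ m → + m * F (suc a) (suc x))))
      (cong (λ m → δ (suc a ℕ.* suc x) n * (m * F (suc a) (suc x))) (ℤₚ.pos-* (suc a) (suc x))))

  D : (ℕ → ℤ) → Series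
  D f = lambert λ a _ → f a

  Σ-⊛ : ∀ N (F : ℕ → Series) g n → ((λ k → Σ< N λ i → F i k) ⊛ g) n ≡ Σ< N (λ i → (F i ⊛ g) n)
  Σ-⊛ zero    F g n = 0⊛ (λ _ → refl) g n
  Σ-⊛ (suc N) F g n =
    trans (⊛-distribʳ g (λ k → Σ< N λ i → F i k) (F N) n) (cong (_+ (F N ⊛ g) n) (Σ-⊛ N F g n))

  δ-⊛ : ∀ l m n → (δ l ⊛ δ m) n ≡ δ (l ℕ.+ m) n
  δ-⊛ zero    m zero    = ℤₚ.*-identityˡ (δ m 0)
  δ-⊛ zero    m (suc n) = trans (cong₂ _+_ (ℤₚ.*-identityˡ (δ m (suc n))) (0⊛ (λ _ → refl) (δ m) n))
                                (ℤₚ.+-identityʳ _)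
  δ-⊛ (suc l) m zero    = ℤₚ.*-zeroˡ (δ m 0)
  δ-⊛ (suc l) m (suc n) = trans (cong (_+ (δ l ⊛ δ m) n) (ℤₚ.*-zeroˡ (δ m (suc n))))
                                (trans (ℤₚ.+-identityˡ _) (δ-⊛ l m n))

  D-⊛ : ∀ f g n → (D f ⊛ D g) n ≡ quadSum n (λ a b → f a * g b)
  D-⊛ f g n = begin
    (D f ⊛ D g) n
      ≡⟨ ≡-Series.⊛-cong≤ n (λ i → lambert-box (λ a _ → f a)) (λ i → lambert-box (λ a _ → g a)) ⟩
    (lambertBox n (λ a _ → f a) ⊛ lambertBox n (λ a _ → g a)) n
      ≡⟨ Σ²-⊛ _ _ n ⟩
    Σ< n (λ a → Σ< n λ x → (m f a x ⊛ lambertBox n (λ a _ → g a)) n)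
      ≡⟨ Σ²-cong n n (λ a x → trans (⊛-comm (m f a x) _ n) (trans (Σ²-⊛ _ _ n)
           (Σ²-cong n n λ b y → trans (⊛-comm (m g b y) (m f a x) n) (m-⊛ a x b y)))) ⟩
    Σ< n (λ a → Σ< n λ x → Σ< n λ b → Σ< n λ y → term n (λ a b → f a * g b) a b x y)
      ≡⟨ Σ-cong n (λ a → Σ-swap n n _) ⟩
    quadSum n (λ a b → f a * g b) ∎
    where
    open ≡-Reasoning
    open +-*-Solver
    m : (ℕ → ℤ) → ℕ → ℕ → Series
    m f a x k = δ (suc a ℕ.* suc x) k * f (suc a)
    Σ²-⊛ : ∀ (F : ℕ → ℕ → Series) h k → ((λ k → Σ< n λ i → Σ< n λ j → F i j k) ⊛ h) k ≡
           Σ< n (λ i → Σ< n λ j → (F i j ⊛ h) k)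
    Σ²-⊛ F h k = trans (Σ-⊛ n (λ i k → Σ< n λ j → F i j k) h k) (Σ-cong n λ i → Σ-⊛ n (F i) h k)
    m-⊛ : ∀ a x b y → (m f a x ⊛ m g b y) n ≡ term n (λ a b → f a * g b) a b x y
    m-⊛ a x b y = begin
      (m f a x ⊛ m g b y) n
        ≡⟨ ≡-Series.⊛-cong (λ k → ℤₚ.*-comm (δₐ k) (f (suc a))) (λ k → ℤₚ.*-comm (δ_b k) (g (suc b))) n ⟩
      ((f (suc a) • δₐ) ⊛ (g (suc b) • δ_b)) n
        ≡⟨ •-⊛ (f (suc a)) δₐ (g (suc b) • δ_b) n ⟩
      f (suc a) * (δₐ ⊛ (g (suc b) • δ_b)) n
        ≡⟨ cong (f (suc a) *_) (trans (⊛-comm δₐ (g (suc b) • δ_b) n) (trans (•-⊛ (g (suc b)) δ_b δₐ n)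
             (cong (g (suc b) *_) (trans (⊛-comm δ_b δₐ n) (δ-⊛ (suc a ℕ.* suc x) (suc b ℕ.* suc y) n))))) ⟩
      f (suc a) * (g (suc b) * δ (suc a ℕ.* suc x ℕ.+ suc b ℕ.* suc y) n)
        ≡⟨ solve 3 (λ f g d → f :* (g :* d) := d :* (f :* g)) refl (f (suc a)) (g (suc b)) _ ⟩
      term n (λ a b → f a * g b) a b x y ∎
      where
      δₐ δ_b : Series
      δₐ  = δ (suc a ℕ.* suc x)
      δ_b = δ (suc b ℕ.* suc y)

  quadSum-cong : ∀ n {G H : ℕ → ℕ → ℤ} → (∀ a b → G a b ≡ H a b) → quadSum n G ≡ quadSum n H
  quadSum-cong n G≗H = Σ²-cong n n λ a b → Σ²-cong n n λ x y →
    cong (δ (suc a ℕ.* suc x ℕ.+ suc b ℕ.* suc y) n *_) (G≗H (suc a) (suc b))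

  quadSum-+ : ∀ n G H → quadSum n (λ a b → G a b + H a b) ≡ quadSum n G + quadSum n H
  quadSum-+ n G H = trans
    (Σ²-cong n n λ a b → trans (Σ²-cong n n λ x y → ℤₚ.*-distribˡ-+ (δ (suc a ℕ.* suc x ℕ.+ suc b ℕ.* suc y) n) (G (suc a) (suc b)) (H (suc a) (suc b)))
       (Σ²-+ n n _ _))
    (Σ²-+ n n _ _)

  quadSum-* : ∀ n c G → quadSum n (λ a b → c * G a b) ≡ c * quadSum n G
  quadSum-* n c G = trans
    (Σ²-cong n n λ a b → trans (Σ²-cong n n λ x y →
       solve 3 (λ d c f → d :* (c :* f) := c :* (d :* f)) refl (δ (suc a ℕ.* suc x ℕ.+ suc b ℕ.* suc y) n) c (G (suc a) (suc b)))
       (Σ²-* n n c _))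
    (Σ²-* n n c _)
    where open +-*-Solver

  quadSum-flip : ∀ n G → quadSum n (flip G) ≡ quadSum n G
  quadSum-flip n G = trans (Σ-swap n n _) (Σ²-cong n n λ b a → trans (Σ-swap n n _) (Σ²-cong n n λ y x →
    cong (λ k → δ k n * G (suc b) (suc a)) (ℕₚ.+-comm (suc a ℕ.* suc x) (suc b ℕ.* suc y))))

  rowSum : (ℕ → ℕ → ℤ) → ℕ → ℤ
  rowSum H a = Σ< (ℕ.pred a) λ i → H a (suc i)

  -- Both diagonals collapse to sums over two variables. On a = b the equation is a(x + y) = n, and
  -- a value s = x + y arises s - 1 times. On x = y it is (a + b)x = n, and for fixed a + b the sum
  -- over b is `rowSum`.
  liouville-lambert : (H : ℕ → ℕ → ℤ) → (∀ a c → H a (a ℕ.+ c) ≡ H (a ℕ.+ c) c) → ∀ n →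
    quadSum n H + D (rowSum H) n ≡
    quadSum n (λ a b → H (a ℕ.+ b) b) + lambert (λ a x → + ℕ.pred x * H a a) n
  liouville-lambert H H-sym n = begin
    quadSum n H + D (rowSum H) n
      ≡⟨ cong (λ z → quadSum n H + z) d₂ ⟨
    quadSum n H + Σ< n (λ a → Σ< n λ b → Σ< n λ x → term n (λ a b → H (a ℕ.+ b) b) a b x x)
      ≡⟨ liouville {n} H H-sym ⟩
    quadSum n (λ a b → H (a ℕ.+ b) b) + Σ< n (λ a → Σ< n λ x → Σ< n λ y → term n H a a x y)
      ≡⟨ cong (λ z → quadSum n (λ a b → H (a ℕ.+ b) b) + z) (Σ-cong n d₁) ⟩
    quadSum n (λ a b → H (a ℕ.+ b) b) + lambert (λ a x → + ℕ.pred x * H a a) n ∎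
    where
    open ≡-Reasoning
    open +-*-Solver
    d₁ : ∀ a → Σ< n (λ x → Σ< n λ y → term n H a a x y) ≡
               Σ< n (λ x → δ (suc a ℕ.* suc x) n * (+ x * H (suc a) (suc a)))
    d₁ a = begin
      Σ< n (λ x → Σ< n λ y → term n H a a x y)
        ≡⟨ Σ²-cong n n (λ x y → cong (λ k → δ k n * H (suc a) (suc a))
             (trans (sym (ℕₚ.*-distribˡ-+ (suc a) (suc x) (suc y))) (cong (λ k → suc a ℕ.* suc k) (ℕₚ.+-suc x y)))) ⟩
      Σ< n (λ x → Σ< n λ y → δ (suc a ℕ.* suc (suc (x ℕ.+ y))) n * H (suc a) (suc a))
        ≡⟨ triangle n n ℕₚ.≤-refl (λ _ s → δ (suc a ℕ.* suc s) n * H (suc a) (suc a))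
             (λ i s n≤s → 0*≡0 _ (δ-> (ℕₚ.≤-trans (s≤s n≤s) (ℕₚ.m≤n*m (suc s) (suc a))))) ⟩
      Σ< n (λ s → Σ< s λ _ → δ (suc a ℕ.* suc s) n * H (suc a) (suc a))
        ≡⟨ Σ-cong n (λ s → trans (Σ-const s _) (solve 3 (λ s d h → s :* (d :* h) := d :* (s :* h)) refl
             (+ s) (δ (suc a ℕ.* suc s) n) (H (suc a) (suc a)))) ⟩
      Σ< n (λ x → δ (suc a ℕ.* suc x) n * (+ x * H (suc a) (suc a))) ∎
    d₂ : Σ< n (λ a → Σ< n λ b → Σ< n λ x → term n (λ a b → H (a ℕ.+ b) b) a b x x) ≡ D (rowSum H) n
    d₂ = begin
      Σ< n (λ a → Σ< n λ b → Σ< n λ x → term n (λ a b → H (a ℕ.+ b) b) a b x x)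
        ≡⟨ trans (Σ-swap n n _) (trans (Σ-cong n λ b → Σ-swap n n _) (Σ-swap n n _)) ⟩
      Σ< n (λ x → Σ< n λ b → Σ< n λ a → term n (λ a b → H (a ℕ.+ b) b) a b x x)
        ≡⟨ Σ-cong n (λ x → trans (Σ²-cong n n λ b a → cong₂ (λ k s → δ k n * H s (suc b))
               (trans (sym (ℕₚ.*-distribʳ-+ (suc x) (suc a) (suc b))) (cong (ℕ._* suc x) (a+b≡ a b))) (a+b≡ a b))
             (triangle n n ℕₚ.≤-refl (λ i s → δ (suc s ℕ.* suc x) n * H (suc s) (suc i))
               (λ i s n≤s → 0*≡0 _ (δ-> (ℕₚ.≤-trans (s≤s n≤s) (ℕₚ.m≤m*n (suc s) (suc x))))))) ⟩
      Σ< n (λ x → Σ< n λ s → Σ< s λ i → δ (suc s ℕ.* suc x) n * H (suc s) (suc i))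
        ≡⟨ trans (Σ-swap n n _) (Σ²-cong n n λ s x → Σ-* s (δ (suc s ℕ.* suc x) n) (λ i → H (suc s) (suc i))) ⟩
      D (rowSum H) n ∎
      where
      a+b≡ : ∀ a b → suc a ℕ.+ suc b ≡ suc (suc (b ℕ.+ a))
      a+b≡ a b = cong suc (trans (ℕₚ.+-suc a b) (cong suc (ℕₚ.+-comm a b)))

  -- Once c(H(a, b) - H(a + b, b)) is the symmetrised product of `f` and `g`, the two quadruple sums
  -- of Liouville's identity combine into the wanted product and only divisor sums are left. The
  -- factor 2 comes from symmetrising.
  convolution : ∀ f g (H : ℕ → ℕ → ℤ) (c : ℤ) →
    (∀ a b → H a (a ℕ.+ b) ≡ H (a ℕ.+ b) b) →
    (∀ a b → c * (H a b - H (a ℕ.+ b) b) ≡ f a * g b + f b * g a) →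
    ∀ n → + 2 * (D f ⊛ D g) n ≡ lambert (λ a x → c * (+ ℕ.pred x * H a a - rowSum H a)) n
  convolution f g H c H-sym H-diff n = begin
    + 2 * (D f ⊛ D g) n
      ≡⟨ cong (+ 2 *_) (D-⊛ f g n) ⟩
    + 2 * quad (λ a b → f a * g b)
      ≡⟨ solve 1 (λ x → con (+ 2) :* x := x :+ x) refl _ ⟩
    quad (λ a b → f a * g b) + quad (λ a b → f a * g b)
      ≡⟨ cong (λ z → quad (λ a b → f a * g b) + z) (quadSum-flip n (λ a b → f a * g b)) ⟨
    quad (λ a b → f a * g b) + quad (λ a b → f b * g a)
      ≡⟨ quadSum-+ n (λ a b → f a * g b) (λ a b → f b * g a) ⟨
    quad (λ a b → f a * g b + f b * g a)
      ≡⟨ quadSum-cong n H-diff ⟨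
    quad (λ a b → c * (H a b - H′ a b))
      ≡⟨ quadSum-* n c (λ a b → H a b - H′ a b) ⟩
    c * quad (λ a b → H a b - H′ a b)
      ≡⟨ cong (c *_) (begin
           quad (λ a b → H a b - H′ a b)
             ≡⟨ solve 2 (λ x y → x := x :+ y :- y) refl _ (quad H′) ⟩
           quad (λ a b → H a b - H′ a b) + quad H′ - quad H′
             ≡⟨ cong (_- quad H′) (trans (sym (quadSum-+ n (λ a b → H a b - H′ a b) H′)) (quadSum-cong n λ a b →
                  solve 2 (λ x y → x :- y :+ y := x) refl (H a b) (H′ a b))) ⟩
           quad H - quad H′
             ≡⟨ solve 3 (λ x y z → x :- y := x :+ z :- (y :+ z)) refl (quad H) (quad H′) (D (rowSum H) n) ⟩
           quad H + D (rowSum H) n - (quad H′ + D (rowSum H) n)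
             ≡⟨ cong (_- (quad H′ + D (rowSum H) n)) (liouville-lambert H H-sym n) ⟩
           quad H′ + l - (quad H′ + D (rowSum H) n)
             ≡⟨ solve 3 (λ x y z → x :+ y :- (x :+ z) := y :+ con -1ℤ :* z) refl (quad H′) l (D (rowSum H) n) ⟩
           l + -1ℤ * D (rowSum H) n
             ≡⟨ trans (lambert-+ (λ a x → + ℕ.pred x * H a a) (λ a _ → -1ℤ * rowSum H a) n)
                  (cong (λ z → l + z) (lambert-* -1ℤ (λ a _ → rowSum H a) n)) ⟨
           lambert (λ a x → + ℕ.pred x * H a a + -1ℤ * rowSum H a) n
             ≡⟨ lambert-cong {λ a x → + ℕ.pred x * H a a + -1ℤ * rowSum H a} {λ a x → + ℕ.pred x * H a a - rowSum H a}
                  (λ a x → cong (λ z → + x * H (suc a) (suc a) + z) (ℤₚ.-1*i≡-i (rowSum H (suc a)))) n ⟩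
           lambert (λ a x → + ℕ.pred x * H a a - rowSum H a) n ∎) ⟩
    c * lambert (λ a x → + ℕ.pred x * H a a - rowSum H a) n
      ≡⟨ lambert-* c (λ a x → + ℕ.pred x * H a a - rowSum H a) n ⟨
    lambert (λ a x → c * (+ ℕ.pred x * H a a - rowSum H a)) n ∎
    where
    open ≡-Reasoning
    open +-*-Solver
    quad = quadSum n
    H′ : ℕ → ℕ → ℤ
    H′ a b = H (a ℕ.+ b) b
    l = lambert (λ a x → + ℕ.pred x * H a a) n

-- Products of level 2 divisor sums, checked by polynomial normalisation

module ConvolutionIdentities where

  open FiniteSums
  open PowerSeries
  open LambertSeries
  open import Data.Integer using (-_; _+_; _*_; _-_)
  open import Data.Integer.Solver using (module +-*-Solver)
  open import Relation.Binary.PropositionalEquality hiding ([_])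

  open +-*-Solver using (Polynomial; op; [+]; [*]; con; var; _:+_; _:*_; _:-_; :-_; _:^_; ⟦_⟧; normalise; ⟦_⟧N; prove)

  ε : ℕ → ℤ
  ε zero    = 1ℤ
  ε (suc n) = - ε n

  ε-± : ∀ n → ε n ≡ 1ℤ ⊎ ε n ≡ -1ℤ
  ε-± zero = inj₁ refl
  ε-± (suc n) with ε-± n
  ... | inj₁ p = inj₂ (cong -_ p)
  ... | inj₂ p = inj₁ (cong -_ p)

  ε-+ : ∀ m n → ε (m ℕ.+ n) ≡ ε m * ε n
  ε-+ zero    n = sym (ℤₚ.*-identityˡ (ε n))
  ε-+ (suc m) n = trans (cong -_ (ε-+ m n)) (ℤₚ.neg-distribˡ-* (ε m) (ε n))

  infixl 9 _[_]
  -- Substitution in the solver's syntax: it expresses `H` at shifted arguments, and it replaces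
  -- signs by the constants ±1 before normalisation, where the solver itself could not use σ² = 1.
  _[_] : ∀ {m n} → Polynomial n → Vec (Polynomial m) n → Polynomial m
  op o p q [ ρ ] = op o (p [ ρ ]) (q [ ρ ])
  con c    [ ρ ] = con c
  var i    [ ρ ] = lookup ρ i
  (p :^ n) [ ρ ] = (p [ ρ ]) :^ n
  (:- p)   [ ρ ] = :- (p [ ρ ])

  ⟦⟧-[] : ∀ {m n} (p : Polynomial n) (τ : Vec (Polynomial m) n) ρ → ⟦ p [ τ ] ⟧ ρ ≡ ⟦ p ⟧ (map (λ q → ⟦ q ⟧ ρ) τ)
  ⟦⟧-[] (op [+] p q) τ ρ = cong₂ _+_ (⟦⟧-[] p τ ρ) (⟦⟧-[] q τ ρ)
  ⟦⟧-[] (op [*] p q) τ ρ = cong₂ _*_ (⟦⟧-[] p τ ρ) (⟦⟧-[] q τ ρ)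
  ⟦⟧-[] (con c)      τ ρ = refl
  ⟦⟧-[] (var i)      τ ρ = sym (lookup-map i (λ q → ⟦ q ⟧ ρ) τ)
  -- The power here is the one in the solver's own semantics; it is reached as the value of a
  -- one-variable polynomial.
  ⟦⟧-[] (p :^ n)     τ ρ = cong (λ z → ⟦ var {1} (# 0) :^ n ⟧ (z ∷ [])) (⟦⟧-[] p τ ρ)
  ⟦⟧-[] (:- p)       τ ρ = cong -_ (⟦⟧-[] p τ ρ)

  -- The variables σ and τ stand for the signs (-1)ᵐ and (-1)ⁿ, so that an identity need only hold at σ, τ = ±1.
  σ τ α β : Polynomial 4
  σ = var (# 0)
  τ = var (# 1)
  α = var (# 2)
  β = var (# 3)

  Identity : Set
  Identity = Polynomial 4 × Polynomial 4

  record Valid± (e : Identity) : Set where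
    constructor valid
    at : ℤ → ℤ → Polynomial 4 → Polynomial 4
    at s t p = p [ con s ∷ con t ∷ α ∷ β ∷ [] ]
    field
      valid₊₊ : normalise (at 1ℤ 1ℤ (proj₁ e)) ≡ normalise (at 1ℤ 1ℤ (proj₂ e))
      valid₊₋ : normalise (at 1ℤ -1ℤ (proj₁ e)) ≡ normalise (at 1ℤ -1ℤ (proj₂ e))
      valid₋₊ : normalise (at -1ℤ 1ℤ (proj₁ e)) ≡ normalise (at -1ℤ 1ℤ (proj₂ e))
      valid₋₋ : normalise (at -1ℤ -1ℤ (proj₁ e)) ≡ normalise (at -1ℤ -1ℤ (proj₂ e))

  by-signs : (e : Identity) → Valid± e → ∀ m n x y →
    ⟦ proj₁ e ⟧ (ε m ∷ ε n ∷ x ∷ y ∷ []) ≡ ⟦ proj₂ e ⟧ (ε m ∷ ε n ∷ x ∷ y ∷ [])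
  by-signs (l , r) v m n x y = cases (ε-± m) (ε-± n)
    where
    open Valid± v
    Holds : ℤ → ℤ → Set
    Holds s t = ⟦ l ⟧ (s ∷ t ∷ x ∷ y ∷ []) ≡ ⟦ r ⟧ (s ∷ t ∷ x ∷ y ∷ [])
    evaluate : ∀ s t → normalise (at s t l) ≡ normalise (at s t r) → Holds s t
    evaluate s t eq = trans (sym (⟦⟧-[] l (con s ∷ con t ∷ α ∷ β ∷ []) ρ))
      (trans (prove ρ (at s t l) (at s t r) (cong (λ N → ⟦ N ⟧N ρ) eq)) (⟦⟧-[] r (con s ∷ con t ∷ α ∷ β ∷ []) ρ))
      where ρ = s ∷ t ∷ x ∷ y ∷ []
    cases : ∀ {s t} → s ≡ 1ℤ ⊎ s ≡ -1ℤ → t ≡ 1ℤ ⊎ t ≡ -1ℤ → Holds s t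
    cases (inj₁ refl) (inj₁ refl) = evaluate 1ℤ 1ℤ valid₊₊
    cases (inj₁ refl) (inj₂ refl) = evaluate 1ℤ -1ℤ valid₊₋
    cases (inj₂ refl) (inj₁ refl) = evaluate -1ℤ 1ℤ valid₋₊
    cases (inj₂ refl) (inj₂ refl) = evaluate -1ℤ -1ℤ valid₋₋

  -- (c , i , j) stands for the monomial c αⁱ βʲ.
  Table : Set
  Table = List (ℤ × ℕ × ℕ)

  tabulated : Table → Polynomial 4
  tabulated []                = con 0ℤ
  tabulated ((c , i , j) ∷ t) = con c :* α :^ i :* β :^ j :+ tabulated t

  signedTable : ℕ → (t₁ tσ tτ tστ : Table) → Polynomial 4
  signedTable d t₁ tσ tτ tστ = con (+ d) :*
    (tabulated t₁ :+ σ :* tabulated tσ :+ τ :* tabulated tτ :+ σ :* τ :* tabulated tστ)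

  -- 4k(α, β), 4k(α, α − β), 4k(β, β − α) or 4l(α, β) according to the parities of α and β. For a symmetric even k,
  -- and an l with l(α, α + β) = l(α + β, β), this shape ensures the symmetry which Liouville's identity requires.
  parityForm : (k l : Polynomial 2) → Polynomial 4
  parityForm k l =
    (con 1ℤ :- σ) :* (con 1ℤ :- τ) :* k [ α ∷ β ∷ [] ] :+ (con 1ℤ :- σ) :* (con 1ℤ :+ τ) :* k [ α ∷ α :- β ∷ [] ] :+
    (con 1ℤ :+ σ) :* (con 1ℤ :- τ) :* k [ β ∷ β :- α ∷ [] ] :+ (con 1ℤ :+ σ) :* (con 1ℤ :+ τ) :* l [ α ∷ β ∷ [] ]

  -- Σ p((-1)ᵃ, a, x) qᵃˣ over a, x ≥ 1; 𝓓 p is the case where p does not involve x.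
  𝓛 : Polynomial 3 → Series
  𝓛 p = lambert λ α x → ⟦ p ⟧ (ε α ∷ + α ∷ + x ∷ [])

  infix 10 _↑
  _↑ : Polynomial 2 → Polynomial 3
  p ↑ = p [ var (# 0) ∷ var (# 1) ∷ [] ]

  𝓓 : Polynomial 2 → Series
  𝓓 p = 𝓛 (p ↑)

  module Convolution (f g : Polynomial 2) (h Φ : Polynomial 4) (c : ℤ) (G : Polynomial 3) where

    -- `empty` and `step` are the two cases of the induction identifying `Φ` with the partial row
    -- sums. In `total`, 1 + α and 1 + β are the positive integers a and x, so a has sign -σ and β
    -- is x - 1; `Φ` is taken at α because `rowSum` stops at a - 1.
    symmetry difference empty step total : Identity
    symmetry   = h [ σ ∷ σ :* τ ∷ α ∷ α :+ β ∷ [] ] , h [ σ :* τ ∷ τ ∷ α :+ β ∷ β ∷ [] ]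
    difference = con c :* (h :- h [ σ :* τ ∷ τ ∷ α :+ β ∷ β ∷ [] ]) ,
                 f [ σ ∷ α ∷ [] ] :* g [ τ ∷ β ∷ [] ] :+ f [ τ ∷ β ∷ [] ] :* g [ σ ∷ α ∷ [] ]
    empty      = Φ [ σ ∷ con 1ℤ ∷ α ∷ con 0ℤ ∷ [] ] , con 0ℤ
    step       = Φ :+ con c :* h [ σ ∷ :- τ ∷ α ∷ con 1ℤ :+ β ∷ [] ] , Φ [ σ ∷ :- τ ∷ α ∷ con 1ℤ :+ β ∷ [] ]
    total      = con c :* (β :* h [ :- σ ∷ :- σ ∷ con 1ℤ :+ α ∷ con 1ℤ :+ α ∷ [] ])
                   :- Φ [ :- σ ∷ σ ∷ con 1ℤ :+ α ∷ α ∷ [] ] ,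
                 G [ :- σ ∷ con 1ℤ :+ α ∷ con 1ℤ :+ β ∷ [] ]

    module _ (v-symmetry : Valid± symmetry) (v-difference : Valid± difference) (v-empty : Valid± empty)
             (v-step : Valid± step) (v-total : Valid± total) where

      private
        f̂ ĝ : ℕ → ℤ
        f̂ m = ⟦ f ⟧ (ε m ∷ + m ∷ [])
        ĝ m = ⟦ g ⟧ (ε m ∷ + m ∷ [])

        H : ℕ → ℕ → ℤ
        H m n = ⟦ h ⟧ (ε m ∷ ε n ∷ + m ∷ + n ∷ [])

        𝓓≗D : ∀ p n → 𝓓 p n ≡ D (λ m → ⟦ p ⟧ (ε m ∷ + m ∷ [])) n
        𝓓≗D p = lambert-cong {λ m x → ⟦ p ↑ ⟧ (ε m ∷ + m ∷ + x ∷ [])} {λ m _ → ⟦ p ⟧ (ε m ∷ + m ∷ [])}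
                  λ m x → ⟦⟧-[] p _ (ε (suc m) ∷ + suc m ∷ + suc x ∷ [])

        ρ : ℕ → ℕ → Vec ℤ 4
        ρ m n = ε m ∷ ε n ∷ + m ∷ + n ∷ []

        h-sum : ∀ m n → ⟦ h [ σ :* τ ∷ τ ∷ α :+ β ∷ β ∷ [] ] ⟧ (ρ m n) ≡ H (m ℕ.+ n) n
        h-sum m n = trans (⟦⟧-[] h _ (ρ m n))
          (cong (λ s → ⟦ h ⟧ (s ∷ ε n ∷ + (m ℕ.+ n) ∷ + n ∷ [])) (sym (ε-+ m n)))

        H-symmetry : ∀ m n → H m (m ℕ.+ n) ≡ H (m ℕ.+ n) n
        H-symmetry m n = trans (cong (λ s → ⟦ h ⟧ (ε m ∷ s ∷ + m ∷ + (m ℕ.+ n) ∷ [])) (ε-+ m n))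
          (trans (sym (⟦⟧-[] h _ (ρ m n))) (trans (by-signs symmetry v-symmetry m n (+ m) (+ n)) (h-sum m n)))

        H-difference : ∀ m n → c * (H m n - H (m ℕ.+ n) n) ≡ f̂ m * ĝ n + f̂ n * ĝ m
        H-difference m n = trans (cong (λ z → c * (H m n - z)) (sym (h-sum m n)))
          (trans (by-signs difference v-difference m n (+ m) (+ n))
            (cong₂ _+_ (cong₂ _*_ (⟦⟧-[] f _ (ρ m n)) (⟦⟧-[] g _ (ρ m n)))
                       (cong₂ _*_ (⟦⟧-[] f _ (ρ m n)) (⟦⟧-[] g _ (ρ m n)))))

        rowSum-Φ : ∀ m n → c * Σ< n (λ i → H m (suc i)) ≡ ⟦ Φ ⟧ (ρ m n)
        rowSum-Φ m zero    = trans (ℤₚ.*-zeroʳ c)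
          (sym (trans (sym (⟦⟧-[] Φ _ (ρ m 0))) (by-signs empty v-empty m 0 (+ m) 0ℤ)))
        rowSum-Φ m (suc n) = trans (ℤₚ.*-distribˡ-+ c _ (H m (suc n))) (trans
          (cong₂ _+_ (rowSum-Φ m n) (cong (c *_) (sym (⟦⟧-[] h _ (ρ m n)))))
          (trans (by-signs step v-step m n (+ m) (+ n)) (⟦⟧-[] Φ _ (ρ m n))))

        diagonal : ∀ m x → c * (+ x * H (suc m) (suc m) - rowSum H (suc m)) ≡
                   ⟦ G ⟧ (ε (suc m) ∷ + suc m ∷ + suc x ∷ [])
        diagonal m x = trans (ℤₚ.*-distribˡ-+ c (+ x * H (suc m) (suc m)) (- rowSum H (suc m))) (trans
          (cong₂ _+_ (cong (λ z → c * (+ x * z)) (sym (⟦⟧-[] h _ ρ′)))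
            (trans (sym (ℤₚ.neg-distribʳ-* c (rowSum H (suc m))))
              (cong -_ (trans (rowSum-Φ (suc m) m) (sym (⟦⟧-[] Φ _ ρ′))))))
          (trans (by-signs total v-total m 0 (+ m) (+ x)) (⟦⟧-[] G _ ρ′)))
          where
          ρ′ : Vec ℤ 4
          ρ′ = ε m ∷ 1ℤ ∷ + m ∷ + x ∷ []

      2*𝓓⊛𝓓 : ∀ n → + 2 * (𝓓 f ⊛ 𝓓 g) n ≡ 𝓛 G n
      2*𝓓⊛𝓓 n = trans (cong (+ 2 *_) (≡-Series.⊛-cong (𝓓≗D f) (𝓓≗D g) n)) (trans (convolution f̂ ĝ H c H-symmetry H-difference n)
        (lambert-cong {λ m x → c * (+ ℕ.pred x * H m m - rowSum H m)}
                      {λ m x → ⟦ G ⟧ (ε m ∷ + m ∷ + x ∷ [])} diagonal n))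

  private
    s₂ a₂ : Polynomial 2
    s₂ = var (# 0)
    a₂ = var (# 1)

    s₃ a₃ x₃ : Polynomial 3
    s₃ = var (# 0)
    a₃ = var (# 1)
    x₃ = var (# 2)

  eᵖ 𝒫ᵖ Qᵖ : Polynomial 2
  eᵖ = con (+ 12) :* (con 1ℤ :- s₂) :* a₂
  𝒫ᵖ = con (- + 8) :* s₂ :* a₂
  Qᵖ = con (+ 16) :* s₂ :* a₂ :^ 3

  -- In each case k (and l) solve the linear equations making c(H(a, b) − H(a + b, b)) the symmetrised product of f and
  -- g, where H = parityForm k l, and Φ is the closed form of c Σ H(s, i) over 0 < i ≤ m, as a polynomial in the signs
  -- of s and m and in s and m.

  module Conv-e𝒫 where
    f g k l : Polynomial 2
    f = eᵖ
    g = 𝒫ᵖ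
    k = let a = var (# 0) ; b = var (# 1) in con (+ 4) :* a :* b :- a :* a :- b :* b
    l = con 0ℤ

    Φ : Polynomial 4
    Φ = signedTable 4
          ((+ 3 , 1 , 0) ∷ (- + 6 , 2 , 0) ∷ [])
          ((+ 2 , 0 , 1) ∷ (+ 6 , 0 , 2) ∷ (+ 4 , 0 , 3) ∷ (- + 6 , 1 , 0) ∷ (- + 6 , 1 , 1) ∷
             (- + 6 , 1 , 2) ∷ (+ 3 , 2 , 0) ∷ (- + 6 , 2 , 1) ∷ [])
          ((- + 3 , 0 , 1) ∷ (- + 3 , 0 , 2) ∷ (- + 3 , 1 , 0) ∷ (- + 6 , 1 , 1) ∷
             (+ 6 , 2 , 0) ∷ [])
          ((- + 3 , 0 , 1) ∷ (- + 3 , 0 , 2) ∷ (+ 6 , 1 , 0) ∷ (+ 12 , 1 , 1) ∷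
             (- + 3 , 2 , 0) ∷ [])

    G : Polynomial 3
    G = let σ = s₃ ; a = a₃ ; x = x₃ in
        con (+ 48) :* x :* (con 1ℤ :- σ) :* a :^ 2 :+ con (+ 32) :* σ :* a :^ 3
          :- con (+ 24) :* (con 1ℤ :- σ) :* a :+ con (+ 16) :* σ :* a

    open Convolution f g (parityForm k l) Φ (+ 12) G

    2𝓓f⊛𝓓g : ∀ n → + 2 * (𝓓 f ⊛ 𝓓 g) n ≡ 𝓛 G n
    2𝓓f⊛𝓓g = 2*𝓓⊛𝓓
      (valid refl refl refl refl) (valid refl refl refl refl) (valid refl refl refl refl)
      (valid refl refl refl refl) (valid refl refl refl refl)

  module Conv-𝒫Q where
    f g k l : Polynomial 2
    -- The coefficient of 𝒫 - e, a series without constant term.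
    f = (con (+ 4) :* s₂ :- con (+ 12)) :* a₂
    g = Qᵖ
    k = let a = var (# 0) ; b = var (# 1) in con (+ 8) :* (a :^ 3 :* b :+ a :* b :^ 3) :+ con (+ 0) :* (a :^ 4 :+ b :^ 4) :+ con (- + 18) :* (a :* a :* b :* b)
    -- `eᵖ` vanishes at even arguments, so where it is a factor l = 0 suffices. Here neither factor
    -- vanishes for a and b both even.
    l = let a = var (# 0) ; b = var (# 1) in (a :- b) :^ 4 :+ a :^ 4 :+ b :^ 4

    Φ : Polynomial 4
    Φ = signedTable 4
          ((- + 3 , 1 , 0) ∷ [])
          ((+ 1 , 1 , 0) ∷ (+ 4 , 2 , 1) ∷ (+ 12 , 2 , 2) ∷ (+ 8 , 2 , 3) ∷ (- + 2 , 3 , 0) ∷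
             (- + 12 , 3 , 1) ∷ (- + 12 , 3 , 2) ∷ (- + 2 , 4 , 0) ∷ (+ 4 , 4 , 1) ∷ [])
          ((- + 2 , 0 , 1) ∷ (+ 4 , 0 , 3) ∷ (+ 2 , 0 , 4) ∷ (+ 3 , 1 , 0) ∷ (- + 18 , 1 , 2) ∷
             (- + 12 , 1 , 3) ∷ (+ 12 , 2 , 1) ∷ (+ 12 , 2 , 2) ∷ [])
          ((- + 2 , 0 , 1) ∷ (+ 4 , 0 , 3) ∷ (+ 2 , 0 , 4) ∷ (- + 1 , 1 , 0) ∷ (+ 6 , 1 , 2) ∷
             (+ 4 , 1 , 3) ∷ (- + 12 , 2 , 1) ∷ (- + 12 , 2 , 2) ∷ (+ 2 , 3 , 0) ∷
             (+ 4 , 3 , 1) ∷ (+ 2 , 4 , 0) ∷ [])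

    G : Polynomial 3
    G = let σ = s₃ ; a = a₃ ; x = x₃ in
        con (+ 32) :* x :* σ :* a :^ 4 :+ con (+ 24) :* a :- con (+ 8) :* σ :* a

    open Convolution f g (parityForm k l) Φ (+ 4) G

    2𝓓f⊛𝓓g : ∀ n → + 2 * (𝓓 f ⊛ 𝓓 g) n ≡ 𝓛 G n
    2𝓓f⊛𝓓g = 2*𝓓⊛𝓓
      (valid refl refl refl refl) (valid refl refl refl refl) (valid refl refl refl refl)
      (valid refl refl refl refl) (valid refl refl refl refl)

  module Conv-ee where
    f g k l : Polynomial 2
    f = eᵖ
    g = eᵖ
    k = let a = var (# 0) ; b = var (# 1) in con -1ℤ :* (a :- b) :^ 2
    l = con 0ℤ

    Φ : Polynomial 4
    Φ = signedTable 12
          ((- + 2 , 0 , 1) ∷ (- + 6 , 0 , 2) ∷ (- + 4 , 0 , 3) ∷ (+ 3 , 1 , 0) ∷ (+ 6 , 1 , 1) ∷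
             (+ 6 , 1 , 2) ∷ (- + 6 , 2 , 0) ∷ (- + 12 , 2 , 1) ∷ [])
          ((+ 2 , 0 , 1) ∷ (+ 6 , 0 , 2) ∷ (+ 4 , 0 , 3) ∷ (- + 3 , 1 , 0) ∷ (- + 6 , 1 , 1) ∷
             (- + 6 , 1 , 2) ∷ [])
          ((- + 3 , 1 , 0) ∷ (- + 6 , 1 , 1) ∷ (+ 6 , 2 , 0) ∷ [])
          ((+ 3 , 1 , 0) ∷ (+ 6 , 1 , 1) ∷ [])

    G : Polynomial 3
    G = let σ = s₃ ; a = a₃ ; x = x₃ in
        con (+ 120) :* a :^ 3 :+ con (+ 24) :* σ :* a :^ 3 :- con (+ 48) :* (con 1ℤ :- σ) :* a

    open Convolution f g (parityForm k l) Φ (+ 72) G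

    2𝓓f⊛𝓓g : ∀ n → + 2 * (𝓓 f ⊛ 𝓓 g) n ≡ 𝓛 G n
    2𝓓f⊛𝓓g = 2*𝓓⊛𝓓
      (valid refl refl refl refl) (valid refl refl refl refl) (valid refl refl refl refl)
      (valid refl refl refl refl) (valid refl refl refl refl)

  module Conv-eQ where
    f g k l : Polynomial 2
    f = eᵖ
    -- The coefficient of 3Q - 2Q₁.
    g = (con (+ 48) :* s₂ :- con (+ 480)) :* a₂ :^ 3
    k = let a = var (# 0) ; b = var (# 1) in con (- + 11) :* (a :^ 3 :* b :+ a :* b :^ 3) :+ con (+ 5) :* (a :^ 4 :+ b :^ 4) :+ con (+ 12) :* (a :* a :* b :* b)
    l = con 0ℤ

    Φ : Polynomial 4
    Φ = signedTable 12
          ((- + 4 , 0 , 1) ∷ (+ 40 , 0 , 3) ∷ (+ 60 , 0 , 4) ∷ (+ 24 , 0 , 5) ∷ (+ 3 , 1 , 0) ∷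
             (- + 60 , 1 , 2) ∷ (- + 120 , 1 , 3) ∷ (- + 60 , 1 , 4) ∷ (+ 60 , 2 , 1) ∷
             (+ 180 , 2 , 2) ∷ (+ 120 , 2 , 3) ∷ (- + 60 , 3 , 0) ∷ (- + 120 , 3 , 1) ∷
             (- + 120 , 3 , 2) ∷ (+ 60 , 4 , 0) ∷ (+ 120 , 4 , 1) ∷ [])
          ((+ 4 , 0 , 1) ∷ (- + 40 , 0 , 3) ∷ (- + 60 , 0 , 4) ∷ (- + 24 , 0 , 5) ∷ (- + 3 , 1 , 0)
             ∷ (+ 60 , 1 , 2) ∷ (+ 120 , 1 , 3) ∷ (+ 60 , 1 , 4) ∷ (- + 24 , 2 , 1) ∷
             (- + 72 , 2 , 2) ∷ (- + 48 , 2 , 3) ∷ (+ 6 , 3 , 0) ∷ (+ 12 , 3 , 1) ∷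
             (+ 12 , 3 , 2) ∷ [])
          ((- + 3 , 1 , 0) ∷ (+ 18 , 1 , 2) ∷ (+ 12 , 1 , 3) ∷ (- + 72 , 2 , 1) ∷ (- + 72 , 2 , 2)
             ∷ (+ 60 , 3 , 0) ∷ (+ 120 , 3 , 1) ∷ (- + 60 , 4 , 0) ∷ [])
          ((+ 3 , 1 , 0) ∷ (- + 18 , 1 , 2) ∷ (- + 12 , 1 , 3) ∷ (- + 36 , 2 , 1) ∷
             (- + 36 , 2 , 2) ∷ (- + 6 , 3 , 0) ∷ (- + 12 , 3 , 1) ∷ [])

    G : Polynomial 3
    G = let σ = s₃ ; a = a₃ ; x = x₃ in
        con (+ 960) :* a :^ 3 :- con (+ 96) :* σ :* a :^ 3 :- con (+ 1008) :* a :^ 5 :- con (+ 24) :* (con 1ℤ :- σ) :* a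

    open Convolution f g (parityForm k l) Φ (+ 144) G

    2𝓓f⊛𝓓g : ∀ n → + 2 * (𝓓 f ⊛ 𝓓 g) n ≡ 𝓛 G n
    2𝓓f⊛𝓓g = 2*𝓓⊛𝓓
      (valid refl refl refl refl) (valid refl refl refl refl) (valid refl refl refl refl)
      (valid refl refl refl refl) (valid refl refl refl refl)

-- The Eisenstein series of level 2 and their differential equations

module EisensteinSeries where

  open FiniteSums
  open PowerSeries
  open LambertSeries
  open ConvolutionIdentities
  open import Data.Integer using (-_; _+_; _*_; _-_)
  open import Data.Integer.Solver using (module +-*-Solver)
  open import Relation.Binary.PropositionalEquality hiding ([_])

  open +-*-Solver using (Polynomial; con; var; _:+_; _:*_; _:-_; :-_; _:^_; ⟦_⟧; solve; _:=_)

  combination : List (ℤ × Polynomial 3) → Polynomial 3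
  combination []             = con 0ℤ
  combination ((c , p) ∷ ps) = con c :* p :+ combination ps

  𝓛-combination : List (ℤ × Polynomial 3) → Series
  𝓛-combination []             n = 0ℤ
  𝓛-combination ((c , p) ∷ ps) n = c * 𝓛 p n + 𝓛-combination ps n

  -- The linear relations needed between Lambert series hold already between their coefficient
  -- polynomials, hence can be checked at σ = ±1.
  𝓛-zero : ∀ ps → Valid± (combination ps [ σ ∷ α ∷ β ∷ [] ] , con 0ℤ) → ∀ n → 𝓛-combination ps n ≡ 0ℤ
  𝓛-zero ps v n = begin
    𝓛-combination ps n        ≡⟨ linear ps ⟩
    𝓛 (combination ps) n      ≡⟨ lambert-cong {λ m x → ⟦ combination ps ⟧ (ε m ∷ + m ∷ + x ∷ [])} {λ _ _ → 0ℤ} (λ m x →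
                                   trans (sym (⟦⟧-[] (combination ps) _ (ε (suc m) ∷ 1ℤ ∷ + suc m ∷ + suc x ∷ [])))
                                         (by-signs _ v (suc m) 0 (+ suc m) (+ suc x))) n ⟩
    lambert (λ _ _ → 0ℤ) n    ≡⟨ zeros n ⟩
    0ℤ                        ∎
    where
    open ≡-Reasoning
    zeros : ∀ n → lambert (λ _ _ → 0ℤ) n ≡ 0ℤ
    zeros n = Σ-vanish n λ m → Σ-vanish n λ x → ℤₚ.*-zeroʳ (δ (suc m ℕ.* suc x) n)
    linear : ∀ ps → 𝓛-combination ps n ≡ 𝓛 (combination ps) n
    linear []             = sym (zeros n)
    linear ((c , p) ∷ ps) = trans
      (cong₂ _+_ (sym (lambert-* c (λ m x → ⟦ p ⟧ (ε m ∷ + m ∷ + x ∷ [])) n)) (linear ps))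
      (sym (lambert-+ (λ m x → c * ⟦ p ⟧ (ε m ∷ + m ∷ + x ∷ [])) (λ m x → ⟦ combination ps ⟧ (ε m ∷ + m ∷ + x ∷ [])) n))

  θ𝓛 : Polynomial 3 → Polynomial 3
  θ𝓛 p = var (# 1) :* var (# 2) :* p

  one-⊛-one : ∀ f g n → ((K 1ℤ ⊕ f) ⊛ (K 1ℤ ⊕ g)) n ≡ K 1ℤ n + (f n + (g n + (f ⊛ g) n))
  one-⊛-one f g n = begin
    ((K 1ℤ ⊕ f) ⊛ (K 1ℤ ⊕ g)) n
      ≡⟨ ⊛-distribʳ (K 1ℤ ⊕ g) (K 1ℤ) f n ⟩
    (K 1ℤ ⊛ (K 1ℤ ⊕ g)) n + (f ⊛ (K 1ℤ ⊕ g)) n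
      ≡⟨ cong₂ _+_ (K-⊛ 1ℤ (K 1ℤ ⊕ g) n) (trans (⊛-comm f (K 1ℤ ⊕ g) n)
           (trans (⊛-distribʳ f (K 1ℤ) g n) (cong₂ _+_ (K-⊛ 1ℤ f n) (⊛-comm g f n)))) ⟩
    1ℤ * (K 1ℤ n + g n) + (1ℤ * f n + (f ⊛ g) n)
      ≡⟨ solve 4 (λ o f g w → con 1ℤ :* (o :+ g) :+ (con 1ℤ :* f :+ w) := o :+ (f :+ (g :+ w))) refl
           (K 1ℤ n) (f n) (g n) _ ⟩
    K 1ℤ n + (f n + (g n + (f ⊛ g) n)) ∎
    where open ≡-Reasoning

  θ-one+ : ∀ p n → θ (K 1ℤ ⊕ 𝓛 p) n ≡ 𝓛 (θ𝓛 p) n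
  θ-one+ p n = trans (ℤₚ.*-distribˡ-+ (+ n) (K 1ℤ n) (𝓛 p n)) (trans
    (cong₂ _+_ (trans (≡-Series.θ-K 1ℤ n) (K0≡0 n)) (θ-lambert (λ m x → ⟦ p ⟧ (ε m ∷ + m ∷ + x ∷ [])) n))
    (ℤₚ.+-identityˡ _))
    where
    K0≡0 : ∀ n → K 0ℤ n ≡ 0ℤ
    K0≡0 zero    = refl
    K0≡0 (suc n) = refl

  Q₁ᵖ : Polynomial 2
  Q₁ᵖ = con (+ 240) :* var (# 1) :^ 3

  -- In terms of the Eisenstein series E₂, E₄ these are e = 2E₂(q²) − E₂(q), 𝒫 = (4E₂(q²) − E₂(q))/3,
  -- Q = (16E₄(q²) − E₄(q))/15 and Q₁ = E₄(q).
  e 𝒫 Q Q₁ : Series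
  e  = K 1ℤ ⊕ 𝓓 eᵖ
  𝒫  = K 1ℤ ⊕ 𝓓 𝒫ᵖ
  Q  = K 1ℤ ⊕ 𝓓 Qᵖ
  Q₁ = K 1ℤ ⊕ 𝓓 Q₁ᵖ

  -- The derivative comes from the diagonal a = b of Liouville's identity, the source of the factor
  -- x in `Conv-e𝒫.G`: the term 48x(1 - σ)a² is 4ax times `eᵖ`.
  θe : ∀ n → (K (+ 2) ⊛ θ e) n ≡ (e ⊛ 𝒫 ⊕ ⊖ Q) n
  θe n = ℤₚ.*-cancelˡ-≡ (+ 2) _ _ (begin
    + 2 * (K (+ 2) ⊛ θ e) n
      ≡⟨ cong (+ 2 *_) (trans (K-⊛ (+ 2) (θ e) n) (cong (+ 2 *_) (θ-one+ (eᵖ ↑) n))) ⟩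
    + 2 * (+ 2 * t)
      ≡⟨ solve 6 (λ t o u v w q → con (+ 2) :* (con (+ 2) :* t) :=
           con (+ 2) :* (o :+ (u :+ (v :+ w)) :+ :- (o :+ q)) :-
           (con (+ 2) :* u :+ (con (+ 2) :* v :+ (con (- + 2) :* q :+ (con 1ℤ :* (con (+ 2) :* w)
             :+ (con (- + 4) :* t :+ con 0ℤ)))))) refl t o u v w q ⟩
    + 2 * (o + (u + (v + w)) + - (o + q)) -
      (+ 2 * u + (+ 2 * v + (- + 2 * q + (1ℤ * (+ 2 * w) + (- + 4 * t + 0ℤ)))))
      ≡⟨ cong₂ (λ x y → + 2 * (x + - (o + q)) - y) (sym (one-⊛-one (𝓓 eᵖ) (𝓓 𝒫ᵖ) n)) (trans
           (cong (λ z → + 2 * u + (+ 2 * v + (- + 2 * q + (1ℤ * z + (- + 4 * t + 0ℤ))))) (Conv-e𝒫.2𝓓f⊛𝓓g n))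
           (𝓛-zero ((+ 2 , eᵖ ↑) ∷ (+ 2 , 𝒫ᵖ ↑) ∷ (- + 2 , Qᵖ ↑) ∷ (1ℤ , Conv-e𝒫.G) ∷ (- + 4 , θ𝓛 (eᵖ ↑)) ∷ [])
             (valid refl refl refl refl) n)) ⟩
    + 2 * (e ⊛ 𝒫 ⊕ ⊖ Q) n - 0ℤ
      ≡⟨ ℤₚ.+-identityʳ _ ⟩
    + 2 * (e ⊛ 𝒫 ⊕ ⊖ Q) n ∎)
    where
    open ≡-Reasoning
    o = K 1ℤ n
    u = 𝓓 eᵖ n
    v = 𝓓 𝒫ᵖ n
    w = (𝓓 eᵖ ⊛ 𝓓 𝒫ᵖ) n
    q = 𝓓 Qᵖ n
    t = 𝓛 (θ𝓛 (eᵖ ↑)) n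

  θQ : ∀ n → θ Q n ≡ ((𝒫 ⊕ ⊖ e) ⊛ Q) n
  θQ n = ℤₚ.*-cancelˡ-≡ (+ 2) _ _ (begin
    + 2 * θ Q n
      ≡⟨ cong (+ 2 *_) (θ-one+ (Qᵖ ↑) n) ⟩
    + 2 * t
      ≡⟨ solve 3 (λ t u w → con (+ 2) :* t := con (+ 2) :* (u :+ w) :- (con (+ 2) :* u :+ (con 1ℤ :* (con (+ 2) :* w)
             :+ (con (- + 2) :* t :+ con 0ℤ)))) refl t u w ⟩
    + 2 * (u + w) - (+ 2 * u + (1ℤ * (+ 2 * w) + (- + 2 * t + 0ℤ)))
      ≡⟨ cong₂ (λ x y → + 2 * x - y) (sym product) (trans
           (cong (λ z → + 2 * u + (1ℤ * z + (- + 2 * t + 0ℤ))) (Conv-𝒫Q.2𝓓f⊛𝓓g n))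
           (𝓛-zero ((+ 2 , Conv-𝒫Q.f ↑) ∷ (1ℤ , Conv-𝒫Q.G) ∷ (- + 2 , θ𝓛 (Qᵖ ↑)) ∷ []) (valid refl refl refl refl) n)) ⟩
    + 2 * ((𝒫 ⊕ ⊖ e) ⊛ Q) n - 0ℤ
      ≡⟨ ℤₚ.+-identityʳ _ ⟩
    + 2 * ((𝒫 ⊕ ⊖ e) ⊛ Q) n ∎)
    where
    open ≡-Reasoning
    t = 𝓛 (θ𝓛 (Qᵖ ↑)) n
    u = 𝓓 Conv-𝒫Q.f n
    w = (𝓓 Conv-𝒫Q.f ⊛ 𝓓 Qᵖ) n
    𝒫-e : ∀ n → (𝒫 ⊕ ⊖ e) n ≡ 𝓓 Conv-𝒫Q.f n
    𝒫-e n = trans (solve 4 (λ o p u f → (o :+ p) :+ :- (o :+ u) :=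
        f :+ (con 1ℤ :* p :+ (con -1ℤ :* u :+ (con -1ℤ :* f :+ con 0ℤ)))) refl (K 1ℤ n) (𝓓 𝒫ᵖ n) (𝓓 eᵖ n) (𝓓 Conv-𝒫Q.f n))
      (trans (cong (λ z → 𝓓 Conv-𝒫Q.f n + z) (𝓛-zero ((1ℤ , 𝒫ᵖ ↑) ∷ (-1ℤ , eᵖ ↑) ∷ (-1ℤ , Conv-𝒫Q.f ↑) ∷ [])
        (valid refl refl refl refl) n)) (ℤₚ.+-identityʳ _))
    product : ((𝒫 ⊕ ⊖ e) ⊛ Q) n ≡ u + w
    product = trans (≡-Series.⊛-cong 𝒫-e (λ _ → refl) n) (trans (⊛-comm (𝓓 Conv-𝒫Q.f) Q n)
      (trans (⊛-distribʳ (𝓓 Conv-𝒫Q.f) (K 1ℤ) (𝓓 Qᵖ) n)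
        (cong₂ _+_ (trans (K-⊛ 1ℤ (𝓓 Conv-𝒫Q.f) n) (ℤₚ.*-identityˡ u)) (⊛-comm (𝓓 Qᵖ) (𝓓 Conv-𝒫Q.f) n))))

  e² : ∀ n → (K (+ 4) ⊛ (e ⊛ e)) n ≡ (Q₁ ⊕ K (+ 3) ⊛ Q) n
  e² n = begin
    (K (+ 4) ⊛ (e ⊛ e)) n
      ≡⟨ trans (K-⊛ (+ 4) (e ⊛ e) n) (cong (+ 4 *_) (one-⊛-one (𝓓 eᵖ) (𝓓 eᵖ) n)) ⟩
    + 4 * (o + (u + (u + w)))
      ≡⟨ solve 5 (λ o u w p q → con (+ 4) :* (o :+ (u :+ (u :+ w))) :=
           (o :+ p) :+ con (+ 3) :* (o :+ q) :+ (con (+ 8) :* u :+ (con (+ 2) :* (con (+ 2) :* w)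
             :+ (con -1ℤ :* p :+ (con (- + 3) :* q :+ con 0ℤ))))) refl o u w p q ⟩
    (o + p) + + 3 * (o + q) + (+ 8 * u + (+ 2 * (+ 2 * w) + (-1ℤ * p + (- + 3 * q + 0ℤ))))
      ≡⟨ cong₂ (λ x y → (o + p) + x + y) (sym (K-⊛ (+ 3) Q n)) (trans
           (cong (λ z → + 8 * u + (+ 2 * z + (-1ℤ * p + (- + 3 * q + 0ℤ)))) (Conv-ee.2𝓓f⊛𝓓g n))
           (𝓛-zero ((+ 8 , eᵖ ↑) ∷ (+ 2 , Conv-ee.G) ∷ (-1ℤ , Q₁ᵖ ↑) ∷ (- + 3 , Qᵖ ↑) ∷ []) (valid refl refl refl refl) n)) ⟩
    (Q₁ ⊕ K (+ 3) ⊛ Q) n + 0ℤ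
      ≡⟨ ℤₚ.+-identityʳ _ ⟩
    (Q₁ ⊕ K (+ 3) ⊛ Q) n ∎
    where
    open ≡-Reasoning
    o = K 1ℤ n
    u = 𝓓 eᵖ n
    w = (𝓓 eᵖ ⊛ 𝓓 eᵖ) n
    p = 𝓓 Q₁ᵖ n
    q = 𝓓 Qᵖ n

  σ₅ᵖ : Polynomial 2
  σ₅ᵖ = var (# 1) :^ 5

  -- Both sides are the level 1 Eisenstein series of weight 6. What matters later is 504 = 7 · 72.
  E₆ : ∀ n → (e ⊛ (K (+ 3) ⊛ Q ⊕ ⊖ (K (+ 2) ⊛ Q₁))) n ≡ K 1ℤ n + - + 504 * 𝓓 σ₅ᵖ n
  E₆ n = ℤₚ.*-cancelˡ-≡ (+ 2) _ _ (begin
    + 2 * (e ⊛ (K (+ 3) ⊛ Q ⊕ ⊖ (K (+ 2) ⊛ Q₁))) n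
      ≡⟨ cong (+ 2 *_) (trans (≡-Series.⊛-cong {e} (λ _ → refl) 3Q-2Q₁ n) (one-⊛-one (𝓓 eᵖ) (𝓓 Conv-eQ.g) n)) ⟩
    + 2 * (o + (u + (r + w)))
      ≡⟨ solve 5 (λ o u w r s → con (+ 2) :* (o :+ (u :+ (r :+ w))) :=
           con (+ 2) :* (o :+ con (- + 504) :* s) :+ (con (+ 2) :* u :+ (con (+ 2) :* r :+ (con 1ℤ :* (con (+ 2) :* w)
             :+ (con (+ 1008) :* s :+ con 0ℤ))))) refl o u w r s ⟩
    + 2 * (o + - + 504 * s) + (+ 2 * u + (+ 2 * r + (1ℤ * (+ 2 * w) + (+ 1008 * s + 0ℤ))))
      ≡⟨ cong (λ z → + 2 * (o + - + 504 * s) + z) (trans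
           (cong (λ z → + 2 * u + (+ 2 * r + (1ℤ * z + (+ 1008 * s + 0ℤ)))) (Conv-eQ.2𝓓f⊛𝓓g n))
           (𝓛-zero ((+ 2 , eᵖ ↑) ∷ (+ 2 , Conv-eQ.g ↑) ∷ (1ℤ , Conv-eQ.G) ∷ (+ 1008 , σ₅ᵖ ↑) ∷ []) (valid refl refl refl refl) n)) ⟩
    + 2 * (o + - + 504 * s) + 0ℤ
      ≡⟨ ℤₚ.+-identityʳ _ ⟩
    + 2 * (o + - + 504 * s) ∎)
    where
    open ≡-Reasoning
    o = K 1ℤ n
    u = 𝓓 eᵖ n
    r = 𝓓 Conv-eQ.g n
    w = (𝓓 eᵖ ⊛ 𝓓 Conv-eQ.g) n
    s = 𝓓 σ₅ᵖ n
    3Q-2Q₁ : ∀ n → (K (+ 3) ⊛ Q ⊕ ⊖ (K (+ 2) ⊛ Q₁)) n ≡ (K 1ℤ ⊕ 𝓓 Conv-eQ.g) n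
    3Q-2Q₁ n = trans (cong₂ (λ x y → x + - y) (K-⊛ (+ 3) Q n) (K-⊛ (+ 2) Q₁ n)) (trans
      (solve 4 (λ o q p r → con (+ 3) :* (o :+ q) :+ :- (con (+ 2) :* (o :+ p)) :=
        (o :+ r) :+ (con (+ 3) :* q :+ (con (- + 2) :* p :+ (con -1ℤ :* r :+ con 0ℤ)))) refl
        (K 1ℤ n) (𝓓 Qᵖ n) (𝓓 Q₁ᵖ n) (𝓓 Conv-eQ.g n))
      (trans (cong (λ z → (K 1ℤ ⊕ 𝓓 Conv-eQ.g) n + z) (𝓛-zero ((+ 3 , Qᵖ ↑) ∷ (- + 2 , Q₁ᵖ ↑) ∷ (-1ℤ , Conv-eQ.g ↑) ∷ [])
        (valid refl refl refl refl) n)) (ℤₚ.+-identityʳ _)))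

-- From the partition recursion to the logarithmic derivative of the generating function

module PartitionSeries where

  open import Defs
  open FiniteSums
  open PowerSeries
  open DifferentialAlgebra
  open LambertSeries
  open ConvolutionIdentities
  open EisensteinSeries
  open import Data.Integer using (-_; _+_; _*_; _-_)
  open import Data.Integer.Solver using (module +-*-Solver)
  open +-*-Solver using (Polynomial)
  open import Relation.Binary.PropositionalEquality hiding ([_])

  -- Turns the guarded summand of the partition recursion into multiplication by a power of q.
  δ-shift : ∀ l f n → (δ l ⊛ f) n ≡ (if l ≤ᵇ n then f (n ∸ l) else 0ℤ)
  δ-shift zero    f zero    = ℤₚ.*-identityˡ (f 0)
  δ-shift zero    f (suc n) = trans (cong₂ _+_ (ℤₚ.*-identityˡ (f (suc n))) (0⊛ (λ _ → refl) f n)) (ℤₚ.+-identityʳ _)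
  δ-shift (suc l) f zero    = ℤₚ.*-zeroˡ (f 0)
  δ-shift (suc l) f (suc n) = trans (cong (_+ (δ l ⊛ f) n) (ℤₚ.*-zeroˡ (f (suc n))))
    (trans (ℤₚ.+-identityˡ _) (trans (δ-shift l f n) (cong (if_then f (n ∸ l) else 0ℤ) (≤ᵇ-suc l n))))
    where
    ≤ᵇ-suc : ∀ l n → (l ≤ᵇ n) ≡ (suc l ≤ᵇ suc n)
    ≤ᵇ-suc zero    n = refl
    ≤ᵇ-suc (suc l) n = refl

  -- The recursion inside partsLe is an anonymous local function. Unification recovers it: after the parameters
  -- of partsLe have been abstracted, the metavariables below can only be its instances, go ok K M k m f being
  -- that recursion at (suc k, m, f) inside partsLe ok K M.
  mutual
    go₁ : (ℕ → Bool) → ℕ → ℕ → ℕ → ℕ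
    go₁ = _

    go : (ℕ → Bool) → ℕ → ℕ → ℕ → ℕ → ℕ → ℕ
    go = _

    go₂ : (ℕ → Bool) → ℕ → ℕ → ℕ → ℕ → ℕ
    go₂ = _

    partsLe-unfold : ∀ ok k m → partsLe ok (suc (suc k)) (suc m) ≡
      go₁ ok (suc (suc k)) (suc m) k ℕ.+
      (if ok (suc k) ∧ (suc k ≤ᵇ suc m) then go ok (suc (suc k)) (suc m) k (m ∸ k) m else 0) ℕ.+
      (if ok (suc (suc k)) ∧ (suc k ≤ᵇ m) then go₂ ok (suc (suc k)) (suc m) k m else 0)
    partsLe-unfold ok k m with suc (suc k) | suc m | m ∸ k
    ... | K | M | x = refl

  module Parts (ok : ℕ → Bool) where

    -- `K` and `M` record the enclosing call of `partsLe` to which the local recursion belongs. `go`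
    -- starts at one part size, so the clauses for `zero` repeat the base case.
    count : ℕ → ℕ → ℕ → ℕ → ℕ → ℕ
    count K M zero    zero    f = 1
    count K M zero    (suc m) f = 0
    count K M (suc k) m       f = go ok K M k m f

    allowed : ℕ → ℕ → Bool
    allowed k m = ok k ∧ (k ≤ᵇ m)

    count-zero : ∀ K M k m → count K M (suc k) m zero ≡ count K M k m zero
    count-zero K M zero    zero    = refl
    count-zero K M zero    (suc m) = refl
    count-zero K M (suc k) m       = refl

    count-suc : ∀ K M k m f → count K M (suc k) m (suc f) ≡
      count K M k m (suc f) ℕ.+ (if allowed (suc k) m then count K M (suc k) (m ∸ suc k) f else 0)
    count-suc K M zero    zero    f = refl
    count-suc K M zero    (suc m) f = refl
    count-suc K M (suc k) m       f = refl

    not-allowed : ∀ k m {x : ℕ} → (k ≤ᵇ m) ≡ false → (if allowed k m then x else 0) ≡ 0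
    not-allowed k m eq rewrite eq | Boolₚ.∧-zeroʳ (ok k) = refl

    count-0-suc : ∀ K M k f → count K M (suc k) 0 (suc f) ≡ count K M k 0 (suc f)
    count-0-suc K M k f = trans (count-suc K M k 0 f)
      (trans (cong (count K M k 0 (suc f) ℕ.+_) (not-allowed (suc k) 0 refl)) (ℕₚ.+-identityʳ _))

    -- Without fuel m is 0, and then the guard suc k ≤ m fails as well, so stopping for lack of fuel
    -- gives the same value. Two enclosing calls are compared at once in order to reach the
    -- normalised `parts`.
    count-fuel : ∀ {K M K′ M′} k f f′ m → m ℕ.≤ f → m ℕ.≤ f′ → count K M k m f ≡ count K′ M′ k m f′
    count-fuel zero    f f′ zero    _ _ = refl
    count-fuel zero    f f′ (suc m) _ _ = refl
    count-fuel {K} {M} {K′} {M′} (suc k) zero zero zero p q =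
      trans (count-zero K M k 0) (trans (count-fuel {K} {M} {K′} {M′} k 0 0 0 p q) (sym (count-zero K′ M′ k 0)))
    count-fuel {K} {M} {K′} {M′} (suc k) zero (suc f′) zero p q =
      trans (count-zero K M k 0) (trans (count-fuel {K} {M} {K′} {M′} k 0 (suc f′) 0 p z≤n) (sym (count-0-suc K′ M′ k f′)))
    count-fuel {K} {M} {K′} {M′} (suc k) (suc f) zero zero p q =
      trans (count-0-suc K M k f) (trans (count-fuel {K} {M} {K′} {M′} k (suc f) 0 0 z≤n q) (sym (count-zero K′ M′ k 0)))
    count-fuel {K} {M} {K′} {M′} (suc k) (suc f) (suc f′) m p q = trans (count-suc K M k m f) (trans
      (cong₂ (λ x y → x ℕ.+ (if allowed (suc k) m then y else 0)) (count-fuel {K} {M} {K′} {M′} k (suc f) (suc f′) m p q)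
        (count-fuel {K} {M} {K′} {M′} (suc k) f f′ (m ∸ suc k) (less p) (less q)))
      (sym (count-suc K′ M′ k m f′)))
      where
      less : ∀ {f} → m ℕ.≤ suc f → m ∸ suc k ℕ.≤ f
      less {f} m≤ = ℕₚ.≤-trans (ℕₚ.∸-monoˡ-≤ (suc k) m≤) (ℕₚ.m∸n≤m f k)

    parts : ℕ → ℕ → ℕ
    parts k m = count 0 0 k m m

    partsLe≡parts : ∀ k m → partsLe ok k m ≡ parts k m
    partsLe≡parts zero    zero    = refl
    partsLe≡parts zero    (suc m) = refl
    partsLe≡parts (suc k) m       = count-fuel {suc k} {m} {0} {0} (suc k) m m m ℕₚ.≤-refl ℕₚ.≤-refl

    parts-suc : ∀ k m → parts (suc k) m ≡ parts k m ℕ.+ (if allowed (suc k) m then parts (suc k) (m ∸ suc k) else 0)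
    parts-suc k zero    = trans (count-zero 0 0 k 0)
      (sym (trans (cong (parts k 0 ℕ.+_) (not-allowed (suc k) 0 refl)) (ℕₚ.+-identityʳ _)))
    parts-suc k (suc m) = trans (count-suc 0 0 k (suc m) m)
      (cong (λ y → parts k (suc m) ℕ.+ (if allowed (suc k) (suc m) then y else 0))
        (count-fuel {0} {0} {0} {0} (suc k) m (m ∸ k) (m ∸ k) (ℕₚ.m∸n≤m m k) ℕₚ.≤-refl))

    parts-stable : ∀ {k m} → m ℕ.≤ k → parts k m ≡ parts m m
    parts-stable {k} {m} m≤k = trans (cong (λ k → parts k m) (sym (ℕₚ.m∸n+n≡m m≤k))) (stable (k ∸ m))
      where
      <⇒≰ᵇ : ∀ j m → (suc (j ℕ.+ m) ≤ᵇ m) ≡ false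
      <⇒≰ᵇ j m with suc (j ℕ.+ m) ≤ᵇ m in eq
      ... | false = refl
      ... | true  = ⊥-elim (ℕₚ.<⇒≱ (s≤s (ℕₚ.m≤n+m m j)) (ℕₚ.≤ᵇ⇒≤ _ _ (subst T (sym eq) tt)))
      stable : ∀ j → parts (j ℕ.+ m) m ≡ parts m m
      stable zero    = refl
      stable (suc j) = trans (parts-suc (j ℕ.+ m) m) (trans
        (cong (parts (j ℕ.+ m) m ℕ.+_) (not-allowed (suc (j ℕ.+ m)) m (<⇒≰ᵇ j m)))
        (trans (ℕₚ.+-identityʳ _) (stable j)))

    χ : ℕ → ℤ
    χ k = if ok k then 1ℤ else 0ℤ

    P : ℕ → Series
    P k n = + parts k n

    -- In other words (1 - χ(k + 1)qᵏ⁺¹)P(k + 1) = P(k): this makes `P k` the product of 1/(1 - qʲ)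
    -- over admissible j ≤ k.
    P-suc : ∀ k n → P (suc k) n ≡ (P k ⊕ χ (suc k) • (δ (suc k) ⊛ P (suc k))) n
    P-suc k n = trans (cong (λ m → + m) (parts-suc k n)) (trans (ℤₚ.pos-+ (parts k n) _) (cong (λ z → P k n + z) summand))
      where
      summand : + (if allowed (suc k) n then parts (suc k) (n ∸ suc k) else 0) ≡
                χ (suc k) * (δ (suc k) ⊛ P (suc k)) n
      summand rewrite δ-shift (suc k) (P (suc k)) n with ok (suc k) | suc k ≤ᵇ n
      ... | false | _     = refl
      ... | true  | false = refl
      ... | true  | true  = sym (ℤₚ.*-identityˡ _)

    multiplesBox : ℕ → ℕ → Series
    multiplesBox N j k = Σ< N λ x → δ (j ℕ.* suc x) k * + j

    -- The series jqʲ/(1 - qʲ), the logarithmic derivative of 1/(1 - qʲ).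
    multiples : ℕ → Series
    multiples j n = multiplesBox n j n

    multiples-box : ∀ {n N} j → n ℕ.≤ N → multiples (suc j) n ≡ multiplesBox N (suc j) n
    multiples-box {n} j n≤N = sym (Σ-extend _ n≤N λ x n≤x →
      0*≡0 _ (δ-> (ℕₚ.≤-trans (s≤s n≤x) (ℕₚ.m≤n*m (suc x) (suc j)))))

    multiples-geometric : ∀ j n → multiples (suc j) n ≡ (+ suc j • δ (suc j) ⊕ δ (suc j) ⊛ multiples (suc j)) n
    multiples-geometric j n = begin
      multiples sj n
        ≡⟨ multiples-box j (ℕₚ.n≤1+n n) ⟩
      multiplesBox (suc n) sj n
        ≡⟨ Σ-front n _ ⟩
      δ (sj ℕ.* 1) n * + sj + Σ< n (λ x → δ (sj ℕ.* suc (suc x)) n * + sj)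
        ≡⟨ cong₂ _+_ (trans (cong (λ k → δ k n * + sj) (ℕₚ.*-identityʳ sj)) (ℤₚ.*-comm (δ sj n) (+ sj)))
             (Σ-cong n λ x → trans (cong (λ k → δ k n * + sj) (ℕₚ.*-suc sj (suc x))) (sym (shifted x))) ⟩
      + sj * δ sj n + Σ< n (λ x → ((λ k → δ (sj ℕ.* suc x) k * + sj) ⊛ δ sj) n)
        ≡⟨ cong (λ z → + sj * δ sj n + z) (trans (sym (Σ-⊛ n (λ x k → δ (sj ℕ.* suc x) k * + sj) (δ sj) n))
             (⊛-comm (multiplesBox n sj) (δ sj) n)) ⟩
      + sj * δ sj n + (δ sj ⊛ multiplesBox n sj) n
        ≡⟨ cong (λ z → + sj * δ sj n + z) (≡-Series.⊛-cong≤ n {δ sj} (λ _ _ → refl) (λ i i≤n → sym (multiples-box j i≤n))) ⟩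
      (+ sj • δ sj ⊕ δ sj ⊛ multiples sj) n ∎
      where
      open ≡-Reasoning
      sj = suc j
      shifted : ∀ x → ((λ k → δ (sj ℕ.* suc x) k * + sj) ⊛ δ sj) n ≡ δ (sj ℕ.+ sj ℕ.* suc x) n * + sj
      shifted x = trans (≡-Series.⊛-cong {g = δ sj} (λ k → ℤₚ.*-comm (δ (sj ℕ.* suc x) k) (+ sj)) (λ _ → refl) n)
        (trans (•-⊛ (+ sj) (δ (sj ℕ.* suc x)) (δ sj) n) (trans (cong (+ sj *_)
          (trans (⊛-comm (δ (sj ℕ.* suc x)) (δ sj) n) (δ-⊛ sj (sj ℕ.* suc x) n))) (ℤₚ.*-comm (+ sj) _)))

  ℤ⟦q⟧ : DifferentialRing
  ℤ⟦q⟧ = record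
    { baseRing = commutativeRing
    ; ι = K ; ι-+ = K-+ ; ι-* = K-* ; ι-neg = K-neg ; ι-0 = λ _ → refl ; ι-1 = λ _ → refl
    ; ∂ = θ ; ∂-cong = θ-cong ; ∂-+ = θ-+ ; ∂-* = θ-* ; ∂-ι = θ-K }
    where open ≡-Series

  module LogDerivative (ok : ℕ → Bool) where
    open Parts ok
    private module R = DifferentialProperties ℤ⟦q⟧
    open R using (_≈_; ∂)

    S : Series
    S = lambert λ a _ → χ a * + a

    S≤ : ℕ → Series
    S≤ zero    = K 0ℤ
    S≤ (suc k) = S≤ k R.+ K (χ (suc k)) R.* multiples (suc k)

    •≈ : ∀ c f → (c • f) ≈ K c ⊛ f
    •≈ c f n = sym (K-⊛ c f n)

    χ² : ∀ k → K (χ k) R.* K (χ k) ≈ K (χ k)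
    χ² k n with ok k
    ... | true  = trans (K-⊛ 1ℤ (K 1ℤ) n) (ℤₚ.*-identityˡ _)
    ... | false = trans (K-⊛ 0ℤ (K 0ℤ) n) (sym (zero-series n))
      where
      zero-series : ∀ n → K 0ℤ n ≡ 0ℤ
      zero-series zero    = refl
      zero-series (suc n) = refl

    θδ : ∀ j → ∂ (δ j) ≈ K (+ j) R.* δ j
    θδ j n = trans (trans (ℤₚ.*-comm (+ n) (δ j n)) (trans (sym (δ-subst j n (λ m → + m))) (ℤₚ.*-comm (δ j n) (+ j))))
      (•≈ (+ j) (δ j) n)

    -- In the inductive step everything is multiplied by the unit 1 - cd, by which `P-suc` replaces
    -- P′ with P k. What remains is ct(1 - cd) = cjd; as c is 0 or 1, c² = c reduces it to the
    -- geometric series t(1 - d) = jd.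
    θP : ∀ k → ∂ (P k) ≈ S≤ k R.* P k
    θP zero n = trans (θP₀ n) (sym (trans (K-⊛ 0ℤ (P 0) n) (ℤₚ.*-zeroˡ (P 0 n))))
      where
      θP₀ : ∀ n → θ (P 0) n ≡ 0ℤ
      θP₀ zero    = refl
      θP₀ (suc n) = ℤₚ.*-zeroʳ (+ suc n)
    θP (suc k) = R.lin₁ (K 1ℤ) (≡-Series.⊛-zero-cancelʳ {K 1ℤ R.+ R.- (c R.* d)} unit _ vanish)
        (solve 2 (λ x y → x :+ con 1ℤ :* con 0ℤ := y :+ con 1ℤ :* (x :- y)) R.refl (∂ P′) ((s R.+ c R.* t) R.* P′))
      where
      open R.ℤ-Solver
      P′ = P (suc k)
      c = K (χ (suc k))
      d = δ (suc k)
      s = S≤ k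
      t = multiples (suc k)
      j = K (+ suc k)
      unit : (K 1ℤ R.+ R.- (c R.* d)) 0 ≡ 1ℤ
      unit = cong (λ z → 1ℤ + - z) (ℤₚ.*-zeroʳ (χ (suc k)))
      P′≈ : P′ ≈ P k R.+ c R.* (d R.* P′)
      P′≈ = R.trans {j = P k ⊕ χ (suc k) • (d ⊛ P′)} (P-suc k) (R.+-congˡ {P k} (•≈ (χ (suc k)) (d ⊛ P′)))
      t≈ : t ≈ j R.* d R.+ d R.* t
      t≈ = R.trans {j = + suc k • d ⊕ d ⊛ t} (multiples-geometric k) (R.+-congʳ {d ⊛ t} (•≈ (+ suc k) d))
      θP′ : ∂ P′ ≈ s R.* P k R.+ c R.* (j R.* d R.* P′ R.+ d R.* ∂ P′)
      θP′ = R.trans (R.∂-cong P′≈) (R.trans (R.∂-+ (P k) _) (R.+-cong (θP k) (R.trans (R.∂-ι* (χ (suc k)) (d R.* P′))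
        (R.*-congˡ (R.trans (R.∂-* d P′) (R.+-congʳ (R.*-congʳ (θδ (suc k)))))))))
      middle : Series
      middle = ∂ P′ R.+ R.- (c R.* d R.* ∂ P′) R.+ R.- (s R.* P k) R.+ R.- (c R.* t R.* P′) R.+ c R.* c R.* d R.* t R.* P′
      vanish : (∂ P′ R.+ R.- ((s R.+ c R.* t) R.* P′)) R.* (K 1ℤ R.+ R.- (c R.* d)) ≈ K 0ℤ
      vanish = R.trans {j = middle} (R.lin₁ {_} {middle} (R.- s) P′≈ (solve 7 (λ x p P s c t d →
            (x :- (s :+ c :* t) :* p) :* (con 1ℤ :- c :* d) :+ :- s :* (P :+ c :* (d :* p)) :=
            (x :- c :* d :* x :- s :* P :- c :* t :* p :+ c :* c :* d :* t :* p) :+ :- s :* p) R.refl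
            (∂ P′) P′ (P k) s c t d))
        (R.lin₃ {middle} (K 1ℤ) (R.- (c R.* P′)) (d R.* t R.* P′) θP′ t≈ (χ² (suc k)) (solve 8 (λ x p P s c t d j →
            (x :- c :* d :* x :- s :* P :- c :* t :* p :+ c :* c :* d :* t :* p)
              :+ (con 1ℤ :* (s :* P :+ c :* (j :* d :* p :+ d :* x)) :+ :- (c :* p) :* (j :* d :+ d :* t)
                :+ d :* t :* p :* c) :=
            con 0ℤ :+ (con 1ℤ :* x :+ :- (c :* p) :* t :+ d :* t :* p :* (c :* c))) R.refl
            (∂ P′) P′ (P k) s c t d j))

    S≤-stable : ∀ {k n} → n ℕ.≤ k → S≤ k n ≡ S n
    S≤-stable {k} {n} n≤k = begin
      S≤ k n
        ≡⟨ expand k ⟩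
      Σ< k (λ a → χ (suc a) * multiples (suc a) n)
        ≡⟨ Σ-cong k (λ a → trans (sym (Σ-* n (χ (suc a)) _)) (Σ-cong n λ x →
             solve 3 (λ c d a → c :* (d :* a) := d :* (c :* a)) refl (χ (suc a)) (δ (suc a ℕ.* suc x) n) (+ suc a))) ⟩
      Σ< k (λ a → Σ< n λ x → δ (suc a ℕ.* suc x) n * (χ (suc a) * + suc a))
        ≡⟨ Σ-extend _ n≤k (λ a n≤a → Σ-vanish n λ x → 0*≡0 _
             (δ-> (ℕₚ.≤-trans (s≤s n≤a) (ℕₚ.m≤m*n (suc a) (suc x))))) ⟩
      S n ∎
      where
      open ≡-Reasoning
      open +-*-Solver
      expand : ∀ k → S≤ k n ≡ Σ< k (λ a → χ (suc a) * multiples (suc a) n)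
      expand zero    = trans (sym (ℤₚ.+-identityʳ _)) (trans (cong (_+ 0ℤ) (R.ι-0 n)) (zero-series n))
        where
        zero-series : ∀ n → K 0ℤ n + 0ℤ ≡ 0ℤ
        zero-series zero    = refl
        zero-series (suc n) = refl
      expand (suc k) = cong₂ _+_ (expand k) (K-⊛ (χ (suc k)) (multiples (suc k)) n)

    generatingFunction : Series
    generatingFunction n = + partsLe ok n n

    θ-generatingFunction : ∀ n → θ generatingFunction n ≡ (S ⊛ generatingFunction) n
    θ-generatingFunction n = trans (cong (+ n *_) (stable ℕₚ.≤-refl)) (trans (θP n n)
      (≡-Series.⊛-cong≤ n (λ i i≤n → S≤-stable i≤n) (λ i i≤n → sym (stable i≤n))))
      where
      stable : ∀ {i} → i ℕ.≤ n → generatingFunction i ≡ P n i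
      stable {i} i≤n = cong (λ m → + m) (trans (partsLe≡parts i i) (sym (parts-stable i≤n)))

  cauchy-sum : ∀ (f g : ℕ → ℕ) n → + sum (applyUpTo (λ j → f j ℕ.* g (n ∸ j)) (suc n)) ≡ ((λ m → + f m) ⊛ (λ m → + g m)) n
  cauchy-sum f g zero    = trans (cong (λ m → + m) (ℕₚ.+-identityʳ (f 0 ℕ.* g 0))) (ℤₚ.pos-* (f 0) (g 0))
  cauchy-sum f g (suc n) = trans (ℤₚ.pos-+ (f 0 ℕ.* g (suc n)) _)
    (cong₂ _+_ (ℤₚ.pos-* (f 0) (g (suc n))) (cauchy-sum (f ∘ suc) g n))

  private
    module All  = LogDerivative (λ _ → true)
    module Even = LogDerivative isEven

  A S : Series
  A n = + a n
  S = All.S ⊕ Even.S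

  A≡ : ∀ n → A n ≡ (All.generatingFunction ⊛ Even.generatingFunction) n
  A≡ n = trans (cong (λ l → + sum l) (Listₚ.map-upTo (λ j → p j ℕ.* pEven (n ∸ j)) (suc n))) (cauchy-sum p pEven n)

  θA : ∀ n → θ A n ≡ (S ⊛ A) n
  θA n = trans (cong (+ n *_) (A≡ n)) (trans
    (R.∂-log-* {s = All.S} {t = Even.S} All.θ-generatingFunction Even.θ-generatingFunction n)
    (≡-Series.⊛-cong {S} (λ _ → refl) (λ i → sym (A≡ i)) n))
    where module R = DifferentialProperties ℤ⟦q⟧

  2χ-even : ∀ m → + 2 * Parts.χ isEven m ≡ 1ℤ + ε m
  2χ-even zero          = refl
  2χ-even (suc zero)    = refl
  2χ-even (suc (suc m)) = trans (2χ-even m) (cong (λ z → 1ℤ + z) (sym (ℤₚ.neg-involutive (ε m))))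

  sᵖ : Polynomial 2
  sᵖ = let open +-*-Solver in (con (+ 3) :+ var (# 0)) :* var (# 1)

  -- To the doubled coefficient the unrestricted parts contribute 2a and the even parts (1 + σ)a.
  2S : ∀ n → + 2 * S n ≡ 𝓓 sᵖ n
  2S n = begin
    + 2 * S n
      ≡⟨ cong (+ 2 *_) (lambert-+ (λ m _ → 1ℤ * + m) (λ m _ → Parts.χ isEven m * + m) n) ⟨
    + 2 * lambert (λ m _ → 1ℤ * + m + Parts.χ isEven m * + m) n
      ≡⟨ lambert-* (+ 2) (λ m _ → 1ℤ * + m + Parts.χ isEven m * + m) n ⟨
    lambert (λ m _ → + 2 * (1ℤ * + m + Parts.χ isEven m * + m)) n
      ≡⟨ lambert-cong {λ m _ → + 2 * (1ℤ * + m + Parts.χ isEven m * + m)} {λ m _ → (+ 3 + ε m) * + m}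
           (λ m _ → pointwise (suc m)) n ⟩
    lambert (λ m _ → (+ 3 + ε m) * + m) n ∎
    where
    open ≡-Reasoning
    open +-*-Solver
    pointwise : ∀ m → + 2 * (1ℤ * + m + Parts.χ isEven m * + m) ≡ (+ 3 + ε m) * + m
    pointwise m = trans
      (solve 2 (λ m c → con (+ 2) :* (con 1ℤ :* m :+ c :* m) := con (+ 2) :* m :+ con (+ 2) :* c :* m) refl (+ m) (Parts.χ isEven m))
      (trans (cong (λ z → + 2 * + m + z * + m) (2χ-even m))
        (solve 2 (λ m e → con (+ 2) :* m :+ (con 1ℤ :+ e) :* m := (con (+ 3) :+ e) :* m) refl (+ m) (ε m)))

  -- Both sides are (E₂(q) + 2E₂(q²))/3, the logarithmic derivative of q/A⁸. The eighth power is the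
  -- one that makes the power of q in η(q)η(q²) integral.
  2𝒫-e : ∀ n → (K (+ 2) ⊛ 𝒫 ⊕ ⊖ e) n ≡ (K 1ℤ ⊕ ⊖ (K (+ 8) ⊛ S)) n
  2𝒫-e n = begin
    (K (+ 2) ⊛ 𝒫 ⊕ ⊖ e) n
      ≡⟨ cong (_+ - e n) (K-⊛ (+ 2) 𝒫 n) ⟩
    + 2 * (o + v) + - (o + u)
      ≡⟨ solve 4 (λ o u v s → con (+ 2) :* (o :+ v) :+ :- (o :+ u) := o :+ :- (con (+ 4) :* s) :+
           (con (+ 2) :* v :+ (con -1ℤ :* u :+ (con (+ 4) :* s :+ con 0ℤ)))) refl o u v s ⟩
    o + - (+ 4 * s) + (+ 2 * v + (-1ℤ * u + (+ 4 * s + 0ℤ)))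
      ≡⟨ cong (λ z → o + - (+ 4 * s) + z) (𝓛-zero ((+ 2 , 𝒫ᵖ ↑) ∷ (-1ℤ , eᵖ ↑) ∷ (+ 4 , sᵖ ↑) ∷ []) (valid refl refl refl refl) n) ⟩
    o + - (+ 4 * s) + 0ℤ
      ≡⟨ trans (ℤₚ.+-identityʳ _) (cong (λ z → o + - (+ 4 * z)) (sym (2S n))) ⟩
    o + - (+ 4 * (+ 2 * S n))
      ≡⟨ cong (λ z → o + - z) (trans (sym (ℤₚ.*-assoc (+ 4) (+ 2) (S n))) (sym (K-⊛ (+ 8) S n))) ⟩
    (K 1ℤ ⊕ ⊖ (K (+ 8) ⊛ S)) n ∎
    where
    open ≡-Reasoning
    open +-*-Solver
    o = K 1ℤ n
    u = 𝓓 eᵖ n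
    v = 𝓓 𝒫ᵖ n
    s = 𝓓 sᵖ n

-- Reduction modulo 7, Frobenius, and the coefficients a(7k - 6)

module Modulo7 where

  open import Defs
  open FiniteSums
  open PowerSeries
  open DifferentialAlgebra
  open LambertSeries
  open ConvolutionIdentities
  open EisensteinSeries
  open PartitionSeries
  open import Data.Integer using (-_; _+_; _*_; _-_)
  open import Data.Integer.Solver using (module +-*-Solver)
  open import Relation.Binary.PropositionalEquality hiding ([_])

  q : Series
  q = δ 1

  θq : ∀ n → θ q n ≡ (K 1ℤ ⊛ q) n
  θq n = trans (ℤₚ.*-comm (+ n) (q n)) (trans (sym (δ-subst 1 n (λ m → + m)))
    (trans (ℤₚ.*-comm (q n) 1ℤ) (sym (K-⊛ 1ℤ q n))))

  private module R = DifferentialProperties ℤ⟦q⟧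
  open R using (_⁸)

  -- The coefficients satisfy (n - 1)f(n) = 0 in ℤ, which has no zero divisors.
  θf≡f : ∀ f → (∀ n → θ f n ≡ f n) → ∀ n → f n ≡ (K (f 1) ⊛ q) n
  θf≡f f eq n = trans (coefficient n) (sym (K-⊛ (f 1) q n))
    where
    open +-*-Solver
    coefficient : ∀ n → f n ≡ f 1 * q n
    coefficient zero          = trans (sym (eq 0)) (trans (ℤₚ.*-zeroˡ (f 0)) (sym (ℤₚ.*-zeroʳ (f 1))))
    coefficient (suc zero)    = sym (ℤₚ.*-identityʳ (f 1))
    coefficient (suc (suc n)) with ℤₚ.i*j≡0⇒i≡0∨j≡0 (+ suc n) {f (suc (suc n))}
        (trans (solve 2 (λ n x → (con 1ℤ :+ n) :* x := (con (+ 2) :+ n) :* x :- x) refl (+ n) (f (suc (suc n))))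
               (ℤₚ.i≡j⇒i-j≡0 (eq (suc (suc n)))))
    ... | inj₂ f≡0 = trans f≡0 (sym (ℤₚ.*-zeroʳ (f 1)))

  -- The constant 64 is found by evaluating the coefficient of q: e² - Q begins with 64q, while `A`
  -- and `Q` have constant term 1.
  A⁸B : ∀ n → (A ⁸ ⊛ (Q ⊛ (e ⊛ e ⊕ ⊖ Q))) n ≡ (K (+ 64) ⊛ q) n
  A⁸B = θf≡f (A ⁸ ⊛ (Q ⊛ (e ⊛ e ⊕ ⊖ Q))) (R.LevelTwo.∂[A⁸B] {e} {𝒫} {Q} θe θQ {A} {S} θA 2𝒫-e)

  ℤ/7⟦q⟧ : DifferentialRing
  ℤ/7⟦q⟧ = record
    { baseRing = commutativeRing
    ; ι = K ; ι-+ = K-+ ; ι-* = K-* ; ι-neg = K-neg ; ι-0 = λ _ → ~-refl ; ι-1 = λ _ → ~-refl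
    ; ∂ = θ ; ∂-cong = θ-cong ; ∂-+ = θ-+ ; ∂-* = θ-* ; ∂-ι = θ-K }
    where open ₇-Series

  K-7 : ∀ n → K (+ 7) n ≡₇ K 0ℤ n
  K-7 zero    = mod₇ 1ℤ refl
  K-7 (suc n) = mod₇ 0ℤ refl

  open Characteristic7 ℤ/7⟦q⟧ K-7 using (_⁷; _≈_; module CubicPartitions)
  private module R₇ = Characteristic7 ℤ/7⟦q⟧ K-7
  open ₇-Series using (~-refl; ~-sym; ~-trans; ~-reflexive; ≡⇒≋)

  E₆≈1 : e ⊛ (K (+ 3) ⊛ Q ⊕ ⊖ (K (+ 2) ⊛ Q₁)) ≈ K 1ℤ
  E₆≈1 n = mod₇ (- + 72 * 𝓓 σ₅ᵖ n) (trans (E₆ n)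
    (solve 2 (λ o s → o :+ con (- + 504) :* s := o :+ con (+ 7) :* (con (- + 72) :* s)) refl (K 1ℤ n) (𝓓 σ₅ᵖ n)))
    where open +-*-Solver

  e²-cancel : ∀ f → (e ⊛ e) ⊛ f ≈ K 0ℤ → f ≈ K 0ℤ
  e²-cancel f p = ₇-Series.⊛-zero-cancelʳ {e ⊛ e} refl f λ n → ~-trans (~-reflexive (⊛-comm f (e ⊛ e) n)) (p n)

  module CP = CubicPartitions {e} {𝒫} {Q} {Q₁} {A} {S} {q}
    (≡⇒≋ θe) (≡⇒≋ θQ) (≡⇒≋ e²) E₆≈1 (≡⇒≋ θA) (≡⇒≋ 2𝒫-e) (≡⇒≋ θq) (≡⇒≋ A⁸B) e²-cancel

  residues : (P : ℕ → Set) → P 0 → P 1 → P 2 → P 3 → P 4 → P 5 → P 6 → ∀ r → r ℕ.< 7 → P r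
  residues P p₀ p₁ p₂ p₃ p₄ p₅ p₆ 0 _ = p₀
  residues P p₀ p₁ p₂ p₃ p₄ p₅ p₆ 1 _ = p₁
  residues P p₀ p₁ p₂ p₃ p₄ p₅ p₆ 2 _ = p₂
  residues P p₀ p₁ p₂ p₃ p₄ p₅ p₆ 3 _ = p₃
  residues P p₀ p₁ p₂ p₃ p₄ p₅ p₆ 4 _ = p₄
  residues P p₀ p₁ p₂ p₃ p₄ p₅ p₆ 5 _ = p₅
  residues P p₀ p₁ p₂ p₃ p₄ p₅ p₆ 6 _ = p₆
  residues P p₀ p₁ p₂ p₃ p₄ p₅ p₆ (suc (suc (suc (suc (suc (suc (suc r)))))))
    (s≤s (s≤s (s≤s (s≤s (s≤s (s≤s (s≤s ())))))))

  pow₇ : ℤ → ℤ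
  pow₇ x = x * x * (x * x) * (x * x) * x

  fermat : ∀ x → pow₇ x ≡₇ x
  fermat x = ~-trans (pow₇-cong x≡r) (~-trans
    (residues (λ r → pow₇ (+ r) ≡₇ + r) (mod₇ (+ 0) refl) (mod₇ (+ 0) refl) (mod₇ (+ 18) refl) (mod₇ (+ 312) refl)
      (mod₇ (+ 2340) refl) (mod₇ (+ 11160) refl) (mod₇ (+ 39990) refl) (x %ℕ 7) (n%ℕd<d x 7))
    (~-sym x≡r))
    where
    open import Data.Integer.DivMod using (_%ℕ_; _/ℕ_; a≡a%ℕn+[a/ℕn]*n; n%ℕd<d)
    x≡r : x ≡₇ + (x %ℕ 7)
    x≡r = mod₇ (x /ℕ 7) (trans (a≡a%ℕn+[a/ℕn]*n x 7) (cong (λ z → + (x %ℕ 7) + z) (ℤₚ.*-comm (x /ℕ 7) (+ 7))))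
    pow₇-cong : ∀ {x y} → x ≡₇ y → pow₇ x ≡₇ pow₇ y
    pow₇-cong p = ≡₇-*-cong (≡₇-*-cong (≡₇-*-cong p² p²) p²) p where p² = ≡₇-*-cong p p

  ⁷-cong : ∀ {f g} → f ≈ g → f ⁷ ≈ g ⁷
  ⁷-cong p = R₇.*-cong (R₇.*-cong (R₇.*-cong p² p²) p²) p where p² = R₇.*-cong p p

  -- Over ℤ/7 the solver itself drops the mixed binomial terms of (c + qg)⁷; Fermat's theorem then
  -- gives c⁷ = c.
  frobenius-step : ∀ f → f ⁷ ≈ K (f 0) ⊕ δ 7 ⊛ ((f ∘ suc) ⁷)
  frobenius-step f = R₇.trans (⁷-cong split) (R₇.trans
    (solve 3 (λ c q g → (c :+ q :* g) ⁷ᵖ := c ⁷ᵖ :+ q ⁷ᵖ :* g ⁷ᵖ) R₇.refl (K (f 0)) q (f ∘ suc))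
    (R₇.+-cong K⁷ (R₇.*-congʳ {(f ∘ suc) ⁷} q⁷)))
    where
    open R₇ using (Polynomial; solve; _:+_; _:*_; _:=_)
    _⁷ᵖ : ∀ {n} → Polynomial n → Polynomial n
    x ⁷ᵖ = x :* x :* (x :* x) :* (x :* x) :* x
    split : f ≈ K (f 0) ⊕ q ⊛ (f ∘ suc)
    split zero    = ~-reflexive (sym (trans (cong (λ z → f 0 + z) (ℤₚ.*-zeroˡ (f 1))) (ℤₚ.+-identityʳ (f 0))))
    split (suc n) = ~-reflexive (sym (trans (ℤₚ.+-identityˡ _) (δ-shift 1 (f ∘ suc) (suc n))))
    c = f 0
    power : ∀ {x y} c d → x ≈ K c → y ≈ K d → x ⊛ y ≈ K (c * d)
    power c d p q = R₇.trans (R₇.*-cong p q) (R₇.sym (₇-Series.K-* c d))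
    K⁷ : K c ⁷ ≈ K c
    K⁷ = R₇.trans {j = K (pow₇ c)}
      (power (c * c * (c * c) * (c * c)) c (power (c * c * (c * c)) (c * c) (power (c * c) (c * c) c² c²) c²) R₇.refl)
      λ { zero → fermat c ; (suc n) → ~-refl }
      where
      c² : K c ⊛ K c ≈ K (c * c)
      c² = R₇.sym (₇-Series.K-* c c)
    shift : ∀ {x y} c d → x ≈ δ c → y ≈ δ d → x ⊛ y ≈ δ (c ℕ.+ d)
    shift c d p q = R₇.trans (R₇.*-cong p q) (≡⇒≋ (δ-⊛ c d))
    q⁷ : q ⁷ ≈ δ 7
    q⁷ = shift 6 1 (shift 4 2 (shift 2 2 q² q²) q²) R₇.refl
      where
      q² : q ⊛ q ≈ δ 2
      q² = ≡⇒≋ (δ-⊛ 1 1)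

  frobenius-suc : ∀ f n → (f ⁷) (7 ℕ.+ n) ≡₇ ((f ∘ suc) ⁷) n
  frobenius-suc f n = ~-trans (frobenius-step f (7 ℕ.+ n)) (~-reflexive
    (trans (ℤₚ.+-identityˡ _) (δ-shift 7 ((f ∘ suc) ⁷) (7 ℕ.+ n))))

  frobenius : ∀ k f → (f ⁷) (k ℕ.* 7) ≡₇ f k
  frobenius zero    f = ~-trans (frobenius-step f 0) (~-reflexive
    (trans (cong (λ z → f 0 + z) (δ-shift 7 ((f ∘ suc) ⁷) 0)) (ℤₚ.+-identityʳ (f 0))))
  frobenius (suc k) f = ~-trans (frobenius-suc f (k ℕ.* 7)) (frobenius k (f ∘ suc))

  frobenius-≢0 : ∀ k r f → suc r ℕ.< 7 → (f ⁷) (k ℕ.* 7 ℕ.+ suc r) ≡₇ 0ℤ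
  frobenius-≢0 zero    r f r<7 = ~-trans (frobenius-step f (suc r)) (~-reflexive
    (trans (ℤₚ.+-identityˡ _) (trans (δ-shift 7 ((f ∘ suc) ⁷) (suc r)) (no-shift r r<7))))
    where
    no-shift : ∀ r → suc r ℕ.< 7 → (if 7 ≤ᵇ suc r then ((f ∘ suc) ⁷) (suc r ∸ 7) else 0ℤ) ≡ 0ℤ
    no-shift 0 _ = refl
    no-shift 1 _ = refl
    no-shift 2 _ = refl
    no-shift 3 _ = refl
    no-shift 4 _ = refl
    no-shift 5 _ = refl
    no-shift (suc (suc (suc (suc (suc (suc r)))))) (s≤s (s≤s (s≤s (s≤s (s≤s (s≤s (s≤s ())))))))
  frobenius-≢0 (suc k) r f r<7 =
    ~-trans (frobenius-suc f (k ℕ.* 7 ℕ.+ suc r)) (frobenius-≢0 k r (f ∘ suc) r<7)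

  residue : ∀ k r → + (k ℕ.* 7 ℕ.+ r) ≡₇ + r
  residue k r = mod₇ (+ k) (trans (ℤₚ.pos-+ (k ℕ.* 7) r) (trans (cong (_+ + r) (ℤₚ.pos-* k 7))
    (solve 2 (λ k r → k :* con (+ 7) :+ r := r :+ con (+ 7) :* k) refl (+ k) (+ r))))
    where open +-*-Solver

  θ⁶ : Series → Series
  θ⁶ f = θ (θ (θ (θ (θ (θ f)))))

  ≡₇-neg : ∀ {x y} → x ≡₇ y → - x ≡₇ - y
  ≡₇-neg {y = y} (mod₇ k refl) = mod₇ (- k)
    (solve 2 (λ y k → :- (y :+ con (+ 7) :* k) := :- y :+ con (+ 7) :* (:- k)) refl y k)
    where open +-*-Solver

  pow₆ : ℤ → ℤ
  pow₆ x = x * x * (x * x) * (x * x)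

  pow₆-cong : ∀ {x y} → x ≡₇ y → pow₆ x ≡₇ pow₆ y
  pow₆-cong p = ≡₇-*-cong (≡₇-*-cong p² p²) p² where p² = ≡₇-*-cong p p

  -- 1 − n⁶ detects the multiples of 7, and h⁷ = h(q⁷) modulo 7.
  f-θ⁶f : ∀ f → f ⊕ ⊖ θ⁶ f ≈ (λ k → f (k ℕ.* 7)) ⁷
  f-θ⁶f f n = subst (λ n → (f ⊕ ⊖ θ⁶ f) n ≡₇ (C ⁷) n) (sym n≡)
    (residues (λ r → ∀ k → (f ⊕ ⊖ θ⁶ f) (k ℕ.* 7 ℕ.+ r) ≡₇ (C ⁷) (k ℕ.* 7 ℕ.+ r)) zero-case
      (nonzero 0 (mod₇ (+ 0) refl) (s≤s (s≤s z≤n))) (nonzero 1 (mod₇ (+ 9) refl) (s≤s (s≤s (s≤s z≤n))))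
      (nonzero 2 (mod₇ (+ 104) refl) (s≤s (s≤s (s≤s (s≤s z≤n)))))
      (nonzero 3 (mod₇ (+ 585) refl) (s≤s (s≤s (s≤s (s≤s (s≤s z≤n))))))
      (nonzero 4 (mod₇ (+ 2232) refl) (s≤s (s≤s (s≤s (s≤s (s≤s (s≤s z≤n)))))))
      (nonzero 5 (mod₇ (+ 6665) refl) (s≤s (s≤s (s≤s (s≤s (s≤s (s≤s (s≤s z≤n))))))))
      (n ℕ.% 7) (DivMod.m%n<n n 7) (n ℕ./ 7))
    where
    open +-*-Solver
    C : Series
    C k = f (k ℕ.* 7)
    n≡ : n ≡ n ℕ./ 7 ℕ.* 7 ℕ.+ n ℕ.% 7
    n≡ = trans (DivMod.m≡m%n+[m/n]*n n 7) (ℕₚ.+-comm (n ℕ.% 7) _)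
    collect : ∀ m x → m * (m * (m * (m * (m * (m * x))))) ≡ pow₆ m * x
    collect = solve 2 (λ m x → m :* (m :* (m :* (m :* (m :* (m :* x))))) :=
      m :* m :* (m :* m) :* (m :* m) :* x) refl
    reduce : ∀ k r → (f ⊕ ⊖ θ⁶ f) (k ℕ.* 7 ℕ.+ r) ≡₇
                     f (k ℕ.* 7 ℕ.+ r) + - (pow₆ (+ r) * f (k ℕ.* 7 ℕ.+ r))
    reduce k r = at (k ℕ.* 7 ℕ.+ r) (residue k r)
      where
      at : ∀ N → + N ≡₇ + r → (f ⊕ ⊖ θ⁶ f) N ≡₇ f N + - (pow₆ (+ r) * f N)
      at N p = ≡₇-+-cong (~-refl {f N}) (≡₇-neg (~-trans (~-reflexive (collect (+ N) (f N)))
        (≡₇-*-cong (pow₆-cong p) (~-refl {f N}))))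
    zero-case : ∀ k → (f ⊕ ⊖ θ⁶ f) (k ℕ.* 7 ℕ.+ 0) ≡₇ (C ⁷) (k ℕ.* 7 ℕ.+ 0)
    zero-case k = ~-trans (reduce k 0) (~-trans
      (~-reflexive (solve 1 (λ x → x :+ :- (con 0ℤ :* x) := x) refl (f (k ℕ.* 7 ℕ.+ 0))))
      (subst (λ m → f m ≡₇ (C ⁷) m) (sym (ℕₚ.+-identityʳ (k ℕ.* 7))) (~-sym (frobenius k C))))
    nonzero : ∀ r → pow₆ (+ suc r) ≡₇ 1ℤ → suc r ℕ.< 7 → ∀ k →
              (f ⊕ ⊖ θ⁶ f) (k ℕ.* 7 ℕ.+ suc r) ≡₇ (C ⁷) (k ℕ.* 7 ℕ.+ suc r)
    nonzero r unit r<7 k = ~-trans (reduce k (suc r)) (~-trans (cancel (f (k ℕ.* 7 ℕ.+ suc r)) unit)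
        (~-sym (frobenius-≢0 k r C r<7)))
      where
      cancel : ∀ x {c} → c ≡₇ 1ℤ → x + - (c * x) ≡₇ 0ℤ
      cancel x p = ~-trans (≡₇-+-cong (~-refl {x}) (≡₇-neg (≡₇-*-cong p (~-refl {x}))))
        (~-reflexive (solve 1 (λ x → x :+ :- (con 1ℤ :* x) := con 0ℤ) refl x))

  -- The coefficient of f⁷ at 7k is f(k), so a seventh power determines its root modulo 7.
  ⁷-injective : ∀ {f g} → f ⁷ ≈ g ⁷ → f ≈ g
  ⁷-injective {f} {g} p k = ~-trans (~-sym (frobenius k f)) (~-trans (p (k ℕ.* 7)) (frobenius k g))

  ⁷-⊛ : ∀ f g → (f ⊛ g) ⁷ ≈ f ⁷ ⊛ g ⁷
  ⁷-⊛ = solve 2 (λ a c → let x = a :* c in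
      x :* x :* (x :* x) :* (x :* x) :* x :=
      a :* a :* (a :* a) :* (a :* a) :* a :* (c :* c :* (c :* c) :* (c :* c) :* c)) R₇.refl
    where open R₇ using (solve; _:*_; _:=_)

  -- The hypothesis says that c inverts r³ − 1 modulo 7.
  θ³-fixed-vanish : ∀ G → θ (θ (θ G)) ≈ G → ∀ r c d → c + 1ℤ - c * (+ r * + r * + r) ≡ + 7 * d →
                    ∀ k → G (k ℕ.* 7 ℕ.+ r) ≡₇ 0ℤ
  θ³-fixed-vanish G fixed r c d unit k = cube-fixed (G N) (~-trans (~-sym (r* (r* (r* ~-refl)))) (fixed N))
    where
    open +-*-Solver
    N = k ℕ.* 7 ℕ.+ r
    r* : ∀ {x y} → x ≡₇ y → + N * x ≡₇ + r * y
    r* = ≡₇-*-cong (residue k r)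
    cube-fixed : ∀ x → + r * (+ r * (+ r * x)) ≡₇ x → x ≡₇ 0ℤ
    cube-fixed x (mod₇ t eq) = mod₇ (c * t + d * x) (begin
      x
        ≡⟨ solve 3 (λ x c r → x := c :* (r :* (r :* (r :* x))) :+ (c :+ con 1ℤ :- c :* (r :* r :* r)) :* x :- c :* x) refl x c (+ r) ⟩
      c * (+ r * (+ r * (+ r * x))) + (c + 1ℤ - c * (+ r * + r * + r)) * x - c * x
        ≡⟨ cong₂ (λ y z → c * y + z * x - c * x) eq unit ⟩
      c * (x + + 7 * t) + + 7 * d * x - c * x
        ≡⟨ solve 4 (λ x c d t → c :* (x :+ con (+ 7) :* t) :+ con (+ 7) :* d :* x :- c :* x :=
             con 0ℤ :+ con (+ 7) :* (c :* t :+ d :* x)) refl x c d t ⟩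
      0ℤ + + 7 * (c * t + d * x) ∎)
      where open ≡-Reasoning

  open CP using (F; w; g)

  -- C(k) = a(7k − 6)
  C : Series
  C k = F (k ℕ.* 7)

  AC : A ⊛ C ≈ w ⊛ q
  AC = ⁷-injective {A ⊛ C} {w ⊛ q} (R₇.trans (⁷-⊛ A C)
    (R₇.trans (R₇.*-congˡ {A ⁷} (R₇.sym (f-θ⁶f F))) CP.A⁷[F-∂⁶F]))

  4C≈gA⁷ : K (+ 4) ⊛ C ≈ g ⊛ A ⁷
  4C≈gA⁷ = difference-zero (K (+ 4) ⊛ C) (g ⊛ A ⁷) (₇-Series.⊛-zero-cancelʳ {A} refl _ (CP.4C AC))
    where
    open R₇ using (solve; con; _:+_; _:*_; _:-_; _:=_)
    difference-zero : ∀ x y → x ⊕ ⊖ y ≈ K 0ℤ → x ≈ y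
    difference-zero x y p = R₇.lin₁ (K 1ℤ) p
      (solve 2 (λ x y → x :+ con 1 :* con 0 := y :+ con 1 :* (x :- y)) R₇.refl x y)

  C-vanish : ∀ r c d → c + 1ℤ - c * (+ r * + r * + r) ≡ + 7 * d → ∀ k → C (k ℕ.* 7 ℕ.+ r) ≡₇ 0ℤ
  C-vanish r c d unit k = quarter C (g ⊛ A ⁷) 4C≈gA⁷ {k ℕ.* 7 ℕ.+ r} (θ³-fixed-vanish (g ⊛ A ⁷) CP.∂³[gA⁷] r c d unit k)
    where
    quarter : ∀ f h → K (+ 4) ⊛ f ≈ h → ∀ {n} → h n ≡₇ 0ℤ → f n ≡₇ 0ℤ
    quarter f h p {n} h≡0 with ~-trans (~-reflexive (sym (K-⊛ (+ 4) f n))) (~-trans (p n) h≡0)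
    ... | mod₇ t eq = mod₇ (+ 2 * t - x) (trans
      -- 2 is the inverse of 4 modulo 7.
      (solve 1 (λ x → x := con (+ 2) :* (con (+ 4) :* x) :- con (+ 7) :* x) refl x)
      (trans (cong (λ z → + 2 * z - + 7 * x) eq)
        (solve 2 (λ t x → con (+ 2) :* (con 0ℤ :+ con (+ 7) :* t) :- con (+ 7) :* x :=
          con 0ℤ :+ con (+ 7) :* (con (+ 2) :* t :- x)) refl t x)))
      where
      open +-*-Solver
      x = f n

  -- The shift by 6 in `F` is undone at 7(m + 1) = 6 + (7m + 1); the index suc m avoids a truncated
  -- subtraction.
  C≡a : ∀ m → C (suc m) ≡ + a (1 ℕ.+ m ℕ.* 7)
  C≡a m = trans (≡-Series.⊛-cong {g = A} q⁶ (λ _ → refl) (suc m ℕ.* 7)) (δ-shift 6 A (suc m ℕ.* 7))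
    where
    shift : ∀ {x y} c d → (∀ n → x n ≡ δ c n) → (∀ n → y n ≡ δ d n) → ∀ n → (x ⊛ y) n ≡ δ (c ℕ.+ d) n
    shift c d p p′ n = trans (≡-Series.⊛-cong p p′ n) (δ-⊛ c d n)
    q⁶ : ∀ n → (q ⊛ q ⊛ (q ⊛ q) ⊛ (q ⊛ q)) n ≡ δ 6 n
    q⁶ = shift 4 2 (shift 2 2 (δ-⊛ 1 1) (δ-⊛ 1 1)) (δ-⊛ 1 1)

  7∣a : ∀ r c d → c + 1ℤ - c * (+ r * + r * + r) ≡ + 7 * d → ∀ k m j → suc m ≡ k ℕ.* 7 ℕ.+ r →
        1 ℕ.+ m ℕ.* 7 ≡ j → 7 ∣ a j
  7∣a r c d unit k m _ m≡ refl = divisible (subst (_≡₇ 0ℤ) (trans (cong C (sym m≡)) (C≡a m)) (C-vanish r c d unit k))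
    where
    divisible : ∀ {x} → + x ≡₇ 0ℤ → 7 ∣ x
    divisible {x} (mod₇ t eq) = divides ℤ.∣ t ∣ (trans (cong ℤ.∣_∣ (trans eq (ℤₚ.+-identityˡ (+ 7 * t))))
      (trans (ℤₚ.abs-* (+ 7) t) (ℕₚ.*-comm 7 ℤ.∣ t ∣)))

-- The arithmetic progressions modulo 49

open import Defs
open import Data.Nat using (_+_; _*_)
open import Relation.Binary.PropositionalEquality
open Modulo7 using (7∣a)

theorem1p4 : (n : ℕ) →
    (7 ∣ a (49 * n + 15)) × (7 ∣ a (49 * n + 29)) ×
    (7 ∣ a (49 * n + 36)) × (7 ∣ a (49 * n + 43))
theorem1p4 n =
  -- The cubes of 3, 5 and 6 are -1 modulo 7, so r³ - 1 = -2 has inverse 3 in these three cases; for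
  -- r = 0 the inverse of -1 is -1.
  7∣a 3 (ℤ.+ 3) (ℤ.- ℤ.+ 11) refl n (n * 7 + 2) _ (sym (ℕₚ.+-suc (n * 7) 2)) (index 2) ,
  7∣a 5 (ℤ.+ 3) (ℤ.- ℤ.+ 53) refl n (n * 7 + 4) _ (sym (ℕₚ.+-suc (n * 7) 4)) (index 4) ,
  7∣a 6 (ℤ.+ 3) (ℤ.- ℤ.+ 92) refl n (n * 7 + 5) _ (sym (ℕₚ.+-suc (n * 7) 5)) (index 5) ,
  -- The index m + 1 = 7n + 7 has residue 0 in the next block, hence suc n.
  7∣a 0 (ℤ.- ℤ.+ 1) (ℤ.+ 0) refl (suc n) (n * 7 + 6) _
    (trans (sym (ℕₚ.+-suc (n * 7) 6)) (trans (ℕₚ.+-comm (n * 7) 7) (sym (ℕₚ.+-identityʳ _)))) (index 6)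
  where
  index : ∀ r → 1 + (n * 7 + r) * 7 ≡ 49 * n + (1 + r * 7)
  index r = solve 2 (λ n r → con 1 :+ (n :* con 7 :+ r) :* con 7 := con 49 :* n :+ (con 1 :+ r :* con 7)) refl n r
    where open Data.Nat.Solver.+-*-Solver
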